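{- Let $G = K_n$ be the complete graph on $n$ vertices with $n > 4$, and let $T_s$ be a star spanning tree of $G$. Then for every spanning tree $T$ of $G$ that is not a star spanning tree, $$\cap(T_s) < \cap(T).$$
   Context: Let $G$ be a connected graph and $T$ a spanning tree of $G$. A cycle-edge of $T$ is an edge of $G$ not in $T$. Each cycle-edge $e$ induces a unique cycle in $T \cup \{e\}$, called a tree-cycle of $T$; $C_T$ is the set of tree-cycles of $T$. The intersection of two tree-cycles is the set of edges of $T$ belonging to both. For $c \in C_T$, the cycle intersection number $\cap_T(c)$ is the number of tree-cycles $c' \in C_T$ with $c' \neq c$ whose intersection with $c$ is non-empty. The tree intersection number of $T$ is $\cap(T) = \cap_G(T) = \frac{1}{2}\sum_{c \in C_T} \cap_T(c)$, i.e. the number of unordered pairs of distinct tree-cycles with non-empty intersection. A star spanning tree is a spanning tree having one vertex that is adjacent in the tree to all other vertices. -}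

module Defs where

open import Data.Fin using (Fin; _<?_)
import Data.Fin.Properties as Fin
open import Data.List using (List; []; _∷_; _∷ʳ_; length; zip; map; filter;
  concatMap; upTo; allFin; cartesianProduct; cartesianProductWith; deduplicate)
import Data.List.Membership.DecPropositional as DecMembership
open import Data.List.Membership.Propositional using (_∈_)
import Data.List.Properties as List
open import Data.List.Relation.Unary.All using (All; all?)
open import Data.List.Relation.Unary.Any using (Any; any?)
open import Data.List.Relation.Unary.Unique.Propositional using (Unique)
import Data.List.Relation.Unary.Unique.DecPropositional as DecUnique
open import Data.Nat using (ℕ; zero; suc; _≤_; _≤?_; _/_)
open import Data.Nat.ListAction using (sum)
open import Data.Product using (_×_; _,_; ∃; uncurry)
import Data.Product.Properties as Product
open import Data.Sum using (_⊎_)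
open import Function using (_∘_)
open import Level using (0ℓ)
open import Relation.Binary using (Rel; Symmetric; Irreflexive; Decidable; DecidableEquality)
open import Relation.Binary.Construct.Closure.ReflexiveTransitive using (Star)
open import Relation.Binary.PropositionalEquality using (_≡_; _≢_; sym)
open import Relation.Nullary using (¬_; Dec)
open import Relation.Nullary.Decidable using (_×-dec_; _⊎-dec_; ¬?)

record Graph (n : ℕ) : Set₁ where
  field
    Adj        : Rel (Fin n) 0ℓ
    adj?       : Decidable Adj
    adj-sym    : Symmetric Adj
    adj-irrefl : Irreflexive _≡_ Adj

open Graph public

K : ∀ n → Graph n
K n = record
  { Adj        = _≢_
  ; adj?       = λ u v → ¬? (u Fin.≟ v)
  ; adj-sym    = λ u≢v → u≢v ∘ sym
  ; adj-irrefl = λ u≡v u≢v → u≢v u≡v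
  }

-- The undirected edge uv is represented by the pair (u , v) with u < v.
Edge : ℕ → Set
Edge n = Fin n × Fin n

_≟ᴱ_ : ∀ {n} → DecidableEquality (Edge n)
_≟ᴱ_ = Product.≡-dec Fin._≟_ Fin._≟_

_∈?_ : ∀ {n} (e : Edge n) (es : List (Edge n)) → Dec (e ∈ es)
_∈?_ = DecMembership._∈?_ _≟ᴱ_

allEdges : ∀ n → List (Edge n)
allEdges n = filter (uncurry _<?_) (cartesianProduct (allFin n) (allFin n))

-- A set of edges is represented by a sublist of allEdges n, kept in the same
-- order. Equality of edge sets is therefore propositional equality of lists.
EdgeSet : ℕ → Set
EdgeSet n = List (Edge n)

_≟ˢ_ : ∀ {n} → DecidableEquality (EdgeSet n)
_≟ˢ_ = List.≡-dec _≟ᴱ_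

edges : ∀ {n} → Graph n → EdgeSet n
edges {n} G = filter (uncurry (adj? G)) (allEdges n)

-- A list of vertices v₀, …, vₖ is read cyclically: its steps are
-- (v₀ , v₁), …, (vₖ₋₁ , vₖ), (vₖ , v₀).
steps : ∀ {n} → List (Fin n) → List (Fin n × Fin n)
steps []       = []
steps (v ∷ vs) = zip (v ∷ vs) (vs ∷ʳ v)

IsCycle : ∀ {n} → Rel (Fin n) 0ℓ → List (Fin n) → Set
IsCycle R w = 3 ≤ length w × Unique w × All (uncurry R) (steps w)

isCycle? : ∀ {n} {R : Rel (Fin n) 0ℓ} → Decidable R → ∀ w → Dec (IsCycle R w)
isCycle? R? w =
  3 ≤? length w ×-dec DecUnique.unique? Fin._≟_ w ×-dec all? (uncurry R?) (steps w)

edgeSet : ∀ {n} → List (Fin n) → EdgeSet n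
edgeSet {n} w =
  filter (λ (u , v) → (u , v) ∈? steps w ⊎-dec (v , u) ∈? steps w) (allEdges n)

Connected : ∀ {n} → Graph n → Set
Connected G = ∀ u v → Star (Adj G) u v

Acyclic : ∀ {n} → Graph n → Set
Acyclic G = ∀ w → ¬ IsCycle (Adj G) w

record IsSpanningTree {n} (G T : Graph n) : Set where
  field
    subgraph  : ∀ {u v} → Adj T u v → Adj G u v
    connected : Connected T
    acyclic   : Acyclic T

IsStarSpanningTree : ∀ {n} → Graph n → Graph n → Set
IsStarSpanningTree G T =
  IsSpanningTree G T × ∃ λ c → ∀ v → v ≢ c → Adj T c v

cycleEdges : ∀ {n} (G T : Graph n) → EdgeSet n
cycleEdges G T = filter (λ e → ¬? (uncurry (adj? T) e)) (edges G)

-- Adjacency in T ∪ {e}.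
AdjWith : ∀ {n} → Graph n → Edge n → Rel (Fin n) 0ℓ
AdjWith T e u v = Adj T u v ⊎ (u , v) ≡ e ⊎ (v , u) ≡ e

adjWith? : ∀ {n} (T : Graph n) (e : Edge n) → Decidable (AdjWith T e)
adjWith? T e u v = adj? T u v ⊎-dec (u , v) ≟ᴱ e ⊎-dec (v , u) ≟ᴱ e

words : ∀ n → ℕ → List (List (Fin n))
words n zero    = [] ∷ []
words n (suc k) = cartesianProductWith _∷_ (allFin n) (words n k)

-- The vertices of a cycle are distinct, so words of length at most n suffice.
-- The same cycle occurs once for each choice of starting vertex and direction.
cyclesWith : ∀ {n} → Graph n → Edge n → List (List (Fin n))
cyclesWith {n} T e =
  filter (isCycle? (adjWith? T e)) (concatMap (words n) (upTo (suc n)))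

-- The set C_T, without repetitions.
treeCycles : ∀ {n} (G T : Graph n) → List (EdgeSet n)
treeCycles G T =
  deduplicate _≟ˢ_ (concatMap (map edgeSet ∘ cyclesWith T) (cycleEdges G T))

Intersect : ∀ {n} → Graph n → EdgeSet n → EdgeSet n → Set
Intersect T c c′ = Any (λ e → e ∈ c′ × e ∈ edges T) c

intersect? : ∀ {n} (T : Graph n) → Decidable (Intersect T)
intersect? T c c′ = any? (λ e → e ∈? c′ ×-dec e ∈? edges T) c

cycleIntersectionNumber : ∀ {n} (G T : Graph n) → EdgeSet n → ℕ
cycleIntersectionNumber G T c =
  length (filter (λ c′ → ¬? (c′ ≟ˢ c) ×-dec intersect? T c c′) (treeCycles G T))

-- The sum counts ordered pairs of distinct intersecting tree-cycles. It is
-- even because intersecting is symmetric, so the division by 2 is exact.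
treeIntersectionNumber : ∀ {n} (G T : Graph n) → ℕ
treeIntersectionNumber G T =
  sum (map (cycleIntersectionNumber G T) (treeCycles G T)) / 2

{-# OPTIONS --safe #-}
module Submission where

-- A cycle-edge uv lies over the tree path from u to v, and two tree-cycles meet
-- exactly when these paths share a tree edge f, that is, when both cycle-edges
-- cross the fundamental cut of f. The proof compares the cycle intersection
-- numbers of single tree-cycles with 2 (n - 3).
--
-- In the star with centre c, the tree-cycle of uv is the triangle u v c. It meets
-- only the triangles of the pairs joining u or v to one of the other n - 3
-- vertices, so its cycle intersection number is at most 2 (n - 3)
-- (star-cycle-bound).
--
-- In an arbitrary spanning tree every cycle intersection number is at least
-- 2 (n - 3) (cycle-bound). Let u and v be the ends of the cycle-edge e. If the cut
-- of the first or of the last edge f of the tree path from u to v has sides of sizes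
-- p, q ≥ 2, then p q ≥ 2 (n - 2) pairs cross this cut, and only f and e have to be
-- discarded (internal-bound). Otherwise these two edges cut off u and v alone, and
-- all pairs through u or v count except e and the two tree edges (pendant-bound).
--
-- A tree that is not a star contains a path p q r s. As n > 4, one of the sides of
-- its middle edge qr has a third vertex. This yields a cycle-edge within that side
-- whose tree-cycle meets those of ps and qs (of ps and pr, if it is the side of q),
-- although it does not cross the cut of qr. Hence at least two tree-cycles have
-- cycle intersection number above 2 (n - 3) (non-star-strict).
--
-- Finally the star has at most as many tree-cycles as any other spanning tree
-- (star-cycleEdges≤, allEdges≤). So the sum over the tree-cycles of T exceeds that
-- of the star by at least two, and the inequality persists after halving.

open import Defs
open import Data.Bool using (Bool; true)
import Data.Bool.Properties as Bool
open import Data.Fin using (Fin; zero; suc; _<?_; punchIn; fromℕ<)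
import Data.Fin.Properties as Fin
open import Data.List using (List; []; _∷_; _++_; _∷ʳ_; length; zip; map; filter;
  concatMap; upTo; allFin; cartesianProduct)
import Data.List.Membership.DecPropositional as DecMembership
open import Data.List.Membership.Propositional using (_∈_; _∉_; find; lose)
open import Data.List.Membership.Propositional.Properties
import Data.List.Properties as List
open import Data.List.Relation.Binary.Permutation.Propositional
  using (_↭_; ↭-refl; ↭-reflexive; ↭-sym; ↭-trans; ↭⇒↭ₛ)
import Data.List.Relation.Binary.Permutation.Propositional.Properties as Perm
import Data.List.Relation.Binary.Permutation.Setoid.Properties as PermSetoid
open import Data.List.Relation.Binary.Subset.Propositional using (_⊆_)
open import Data.List.Relation.Unary.All using (All; []; _∷_; all?)
import Data.List.Relation.Unary.All as All
import Data.List.Relation.Unary.All.Properties as All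
open import Data.List.Relation.Unary.AllPairs using ([]; _∷_)
open import Data.List.Relation.Unary.Any using (Any; here; there; any?)
import Data.List.Relation.Unary.Unique.DecPropositional.Properties as DecUnique
open import Data.List.Relation.Unary.Unique.Propositional using (Unique)
import Data.List.Relation.Unary.Unique.Propositional.Properties as Unique
open import Data.Nat using (ℕ; zero; suc; _+_; _*_; _∸_; _/_; _≤_; _<_; z≤n; s≤s)
open import Data.Nat.DivMod using (m/n≡1+[m∸n]/n; /-monoˡ-≤)
open import Data.Nat.ListAction using (sum)
import Data.Nat.Properties as ℕ
open import Data.Nat.Tactic.RingSolver using (solve-∀)
open import Data.Product using (_×_; _,_; proj₁; proj₂; ∃; ∃₂; swap; uncurry)
open import Data.Sum using (_⊎_; inj₁; inj₂; [_,_]′)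
open import Function using (_∘_; mk⇔)
open import Level using (0ℓ)
open import Relation.Binary using (Rel; Decidable; tri<; tri≈; tri>)
open import Relation.Binary.Construct.Closure.ReflexiveTransitive using (Star; ε; _◅_; _◅◅_)
open import Relation.Binary.PropositionalEquality
  using (_≡_; _≢_; refl; sym; trans; cong; cong₂; subst; subst₂; setoid)
open import Relation.Unary using () renaming (Decidable to Decidable₁)
open import Relation.Nullary using (¬_; Dec; yes; no; does; contradiction)
open import Relation.Nullary.Decidable
  using (¬?; map′; _×-dec_; _⊎-dec_; dec-true; decidable-stable; does-⇔)

-- Counting with lists

∈⇒≢ : ∀ {A : Set} {x y : A} {xs} → All (x ≢_) xs → y ∈ xs → x ≢ y
∈⇒≢ x≢ y∈ = All.lookup x≢ y∈

unique-⊆⇒length≤ : ∀ {A : Set} {xs ys : List A} → Unique xs → xs ⊆ ys → length xs ≤ length ys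
unique-⊆⇒length≤ [] _ = z≤n
unique-⊆⇒length≤ {xs = x ∷ xs} (x≢ ∷ uniq) sub with ∈-∃++ (sub (here refl))
... | as , bs , refl = ℕ.≤-trans
  (s≤s (unique-⊆⇒length≤ uniq shrink))
  (ℕ.≤-reflexive (trans (cong suc (List.length-++ as))
    (sym (trans (List.length-++ as) (ℕ.+-suc (length as) (length bs))))))
  where
  shrink : xs ⊆ as ++ bs
  shrink y∈xs with ∈-++⁻ as (sub (there y∈xs))
  ... | inj₁ y∈as = ∈-++⁺ˡ y∈as
  ... | inj₂ (here refl) = contradiction refl (∈⇒≢ x≢ y∈xs)
  ... | inj₂ (there y∈bs) = ∈-++⁺ʳ as y∈bs

unique-map : ∀ {A B : Set} (f : A → B) {xs} →
  (∀ {x y} → x ∈ xs → y ∈ xs → f x ≡ f y → x ≡ y) → Unique xs → Unique (map f xs)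
unique-map f inj [] = []
unique-map f inj (x≢ ∷ uniq) =
  All.map⁺ (All.tabulate λ y∈ fx≡fy → ∈⇒≢ x≢ y∈ (inj (here refl) (there y∈) fx≡fy)) ∷
  unique-map f (λ x∈ y∈ → inj (there x∈) (there y∈)) uniq

length-cartesianProduct : ∀ {A B : Set} (xs : List A) (ys : List B) →
  length (cartesianProduct xs ys) ≡ length xs * length ys
length-cartesianProduct [] ys = refl
length-cartesianProduct (x ∷ xs) ys = trans (List.length-++ (map (x ,_) ys))
  (cong₂ _+_ (List.length-map (x ,_) ys) (length-cartesianProduct xs ys))

module _ {A : Set} (f : A → ℕ) (b : ℕ) where

  sum-map-≤ : ∀ xs → (∀ {x} → x ∈ xs → f x ≤ b) → sum (map f xs) ≤ length xs * b
  sum-map-≤ [] _ = z≤n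
  sum-map-≤ (x ∷ xs) h = ℕ.+-mono-≤ (h (here refl)) (sum-map-≤ xs (h ∘ there))

  sum-map-≥ : ∀ xs → (∀ {x} → x ∈ xs → b ≤ f x) → length xs * b ≤ sum (map f xs)
  sum-map-≥ [] _ = z≤n
  sum-map-≥ (x ∷ xs) h = ℕ.+-mono-≤ (h (here refl)) (sum-map-≥ xs (h ∘ there))

  sum-map-≥₁ : ∀ {x} xs → (∀ {x} → x ∈ xs → b ≤ f x) → x ∈ xs → b < f x →
    length xs * b < sum (map f xs)
  sum-map-≥₁ (x ∷ xs) h (here refl) b<fx = ℕ.+-mono-≤ b<fx (sum-map-≥ xs (h ∘ there))
  sum-map-≥₁ (x ∷ xs) h (there x∈) b<fx =
    ℕ.+-mono-≤-< (h (here refl)) (sum-map-≥₁ xs (h ∘ there) x∈ b<fx)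

  -- Two distinct entries above the bound give a surplus of two, which survives
  -- halving.
  sum-map-≥₂ : ∀ {x y} xs → (∀ {x} → x ∈ xs → b ≤ f x) →
    x ∈ xs → y ∈ xs → x ≢ y → b < f x → b < f y → 2 + length xs * b ≤ sum (map f xs)
  sum-map-≥₂ (_ ∷ _) h (here refl) (here refl) x≢y _ _ = contradiction refl x≢y
  sum-map-≥₂ (_ ∷ xs) h (here refl) (there y∈) _ b<fx b<fy =
    ℕ.≤-trans (ℕ.≤-reflexive (cong suc (sym (ℕ.+-suc b _))))
      (ℕ.+-mono-≤ b<fx (sum-map-≥₁ xs (h ∘ there) y∈ b<fy))
  sum-map-≥₂ (_ ∷ xs) h (there x∈) (here refl) _ b<fx b<fy =
    ℕ.≤-trans (ℕ.≤-reflexive (cong suc (sym (ℕ.+-suc b _))))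
      (ℕ.+-mono-≤ b<fy (sum-map-≥₁ xs (h ∘ there) x∈ b<fx))
  sum-map-≥₂ (_ ∷ xs) h (there x∈) (there y∈) x≢y b<fx b<fy =
    ℕ.≤-trans (ℕ.≤-reflexive (sym (trans (ℕ.+-suc b _) (cong suc (ℕ.+-suc b _)))))
      (ℕ.+-mono-≤ (h (here refl)) (sum-map-≥₂ xs (h ∘ there) x∈ y∈ x≢y b<fx b<fy))

outside? : ∀ {n} (vs : List (Fin n)) → Decidable₁ (_∉ vs)
outside? vs u = ¬? (DecMembership._∈?_ Fin._≟_ u vs)

-- The vertices outside a given list.
others : ∀ {n} → List (Fin n) → List (Fin n)
others {n} vs = filter (outside? vs) (allFin n)

∈-others⁺ : ∀ {n} {u : Fin n} {vs} → u ∉ vs → u ∈ others vs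
∈-others⁺ {u = u} = ∈-filter⁺ _ (∈-allFin u)

∈-others⁻ : ∀ {n} {u : Fin n} vs → u ∈ others vs → u ∉ vs
∈-others⁻ {n} vs u∈ = proj₂ (∈-filter⁻ (outside? vs) {xs = allFin n} u∈)

others-unique : ∀ {n} (vs : List (Fin n)) → Unique (others vs)
others-unique {n} vs = Unique.filter⁺ _ (Unique.allFin⁺ n)

length-allFin : ∀ n → length (allFin n) ≡ n
length-allFin n = List.length-tabulate {n = n} (λ i → i)

length-others≥ : ∀ {n} (vs : List (Fin n)) → n ≤ length vs + length (others vs)
length-others≥ {n} vs = subst₂ _≤_ (length-allFin n) (List.length-++ vs)
  (unique-⊆⇒length≤ (Unique.allFin⁺ n) cover)
  where
  cover : allFin n ⊆ vs ++ others vs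
  cover {u} _ with DecMembership._∈?_ Fin._≟_ u vs
  ... | yes u∈ = ∈-++⁺ˡ u∈
  ... | no u∉ = ∈-++⁺ʳ vs (∈-others⁺ u∉)

unique⇒length≤ : ∀ {n} {vs : List (Fin n)} → Unique vs → length vs ≤ n
unique⇒length≤ {n} {vs} uniq = subst (length vs ≤_) (length-allFin n)
  (unique-⊆⇒length≤ uniq (λ {u} _ → ∈-allFin u))

length-others≤ : ∀ {n} {vs : List (Fin n)} → Unique vs → length vs + length (others vs) ≤ n
length-others≤ {n} {vs} uniq = subst (_≤ n) (List.length-++ vs)
  (unique⇒length≤ (Unique.++⁺ uniq (others-unique vs) (λ (u∈ , u∈′) → ∈-others⁻ vs u∈′ u∈)))

outside : ∀ {n} (vs : List (Fin n)) → length vs < n → ∃ λ u → u ∉ vs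
outside {n} vs short = pick (others vs) (∈-others⁻ vs) (length-others≥ vs)
  where
  pick : ∀ us → (∀ {u} → u ∈ us → u ∉ vs) → n ≤ length vs + length us → ∃ λ u → u ∉ vs
  pick [] _ n≤ = contradiction short (ℕ.≤⇒≯ (ℕ.≤-trans n≤ (ℕ.≤-reflexive (ℕ.+-identityʳ _))))
  pick (u ∷ _) out _ = u , out (here refl)

-- Undirected edges

infix 4 _∼_

-- Equality of vertex pairs up to swapping the ends. By computation,
-- AdjWith T e u v is Adj T u v ⊎ (u , v) ∼ e.
_∼_ : ∀ {n} → Edge n → Edge n → Set
p ∼ e = p ≡ e ⊎ swap p ≡ e

_∼?_ : ∀ {n} (e f : Edge n) → Dec (e ∼ f)
p ∼? e = p ≟ᴱ e ⊎-dec swap p ≟ᴱ e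

∼-sym : ∀ {n} {p q : Edge n} → p ∼ q → q ∼ p
∼-sym (inj₁ refl) = inj₁ refl
∼-sym (inj₂ refl) = inj₂ refl

∼-trans : ∀ {n} {p q r : Edge n} → p ∼ q → q ∼ r → p ∼ r
∼-trans (inj₁ refl) q = q
∼-trans (inj₂ refl) (inj₁ refl) = inj₂ refl
∼-trans (inj₂ refl) (inj₂ refl) = inj₁ refl

∼-end : ∀ {n} {a b x y : Fin n} → (a , b) ∼ (x , y) → a ≡ x ⊎ a ≡ y
∼-end (inj₁ refl) = inj₁ refl
∼-end (inj₂ refl) = inj₂ refl

-- The pair representing the undirected edge uv, provided u ≢ v.
orient : ∀ {n} → Fin n → Fin n → Edge n
orient u v with u <? v
... | yes _ = u , v
... | no  _ = v , u

orient-∼ : ∀ {n} (u v : Fin n) → orient u v ∼ (u , v)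
orient-∼ u v with u <? v
... | yes _ = inj₁ refl
... | no  _ = inj₂ refl

∈-allEdges⁺ : ∀ {n} {u v : Fin n} → u Data.Fin.< v → (u , v) ∈ allEdges n
∈-allEdges⁺ {u = u} {v} u<v = ∈-filter⁺ _ (∈-cartesianProduct⁺ (∈-allFin u) (∈-allFin v)) u<v

∈-allEdges⁻ : ∀ {n} {u v : Fin n} → (u , v) ∈ allEdges n → u Data.Fin.< v
∈-allEdges⁻ {n} e∈ =
  proj₂ (∈-filter⁻ (λ (u , v) → u <? v) {xs = cartesianProduct (allFin n) (allFin n)} e∈)

allEdges-unique : ∀ n → Unique (allEdges n)
allEdges-unique n =
  Unique.filter⁺ _ (Unique.cartesianProduct⁺ (Unique.allFin⁺ n) (Unique.allFin⁺ n))

∈-allEdges⇒≢ : ∀ {n} {u v : Fin n} → (u , v) ∈ allEdges n → u ≢ v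
∈-allEdges⇒≢ e∈ = Fin.<⇒≢ (∈-allEdges⁻ e∈)

orient-∈ : ∀ {n} {u v : Fin n} → u ≢ v → orient u v ∈ allEdges n
orient-∈ {u = u} {v} u≢v with u <? v
... | yes u<v = ∈-allEdges⁺ u<v
... | no u≮v with Fin.<-cmp u v
...   | tri< u<v _ _ = contradiction u<v u≮v
...   | tri≈ _ u≡v _ = contradiction u≡v u≢v
...   | tri> _ _ v<u = ∈-allEdges⁺ v<u

ends-≢ : ∀ {n} {u v : Fin n} {e} → e ∈ allEdges n → (u , v) ∼ e → u ≢ v
ends-≢ e∈ (inj₁ refl) = ∈-allEdges⇒≢ e∈
ends-≢ e∈ (inj₂ refl) = ∈-allEdges⇒≢ e∈ ∘ sym

∼⇒≡ : ∀ {n} {e f : Edge n} → e ∈ allEdges n → f ∈ allEdges n → e ∼ f → e ≡ f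
∼⇒≡ _ _ (inj₁ e≡f) = e≡f
∼⇒≡ e∈ f∈ (inj₂ refl) = contradiction (∈-allEdges⁻ e∈) (Fin.<-asym (∈-allEdges⁻ f∈))

orient-≡ : ∀ {n} {u v : Fin n} {e} → u ≢ v → e ∈ allEdges n → (u , v) ∼ e → orient u v ≡ e
orient-≡ u≢v e∈ uv∼e = ∼⇒≡ (orient-∈ u≢v) e∈ (∼-trans (orient-∼ _ _) uv∼e)

orient-injective : ∀ {n} {u v x y : Fin n} → orient u v ≡ orient x y → (u , v) ∼ (x , y)
orient-injective {u = u} {v} {x} {y} eq =
  ∼-trans (∼-sym (orient-∼ u v)) (∼-trans (inj₁ eq) (orient-∼ x y))

-- Edge sets of closed walks

edgeSet-∈⁻ : ∀ {n} {w : List (Fin n)} {e} → e ∈ edgeSet w →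
  e ∈ allEdges n × ∃ λ p → p ∈ steps w × p ∼ e
edgeSet-∈⁻ {n} {w} {u , v} e∈ with ∈-filter⁻ _ {xs = allEdges n} e∈
... | e∈all , inj₁ uv∈ = e∈all , (u , v) , uv∈ , inj₁ refl
... | e∈all , inj₂ vu∈ = e∈all , (v , u) , vu∈ , inj₂ refl

edgeSet-∈⁺ : ∀ {n} {w : List (Fin n)} {e p} → e ∈ allEdges n → p ∈ steps w → p ∼ e → e ∈ edgeSet w
edgeSet-∈⁺ e∈ p∈ (inj₁ refl) = ∈-filter⁺ _ e∈ (inj₁ p∈)
edgeSet-∈⁺ e∈ p∈ (inj₂ refl) = ∈-filter⁺ _ e∈ (inj₂ p∈)

edgeSet-cong : ∀ {n} {w w′ : List (Fin n)} →
  (∀ {p} → p ∈ steps w → ∃ λ q → q ∈ steps w′ × q ∼ p) →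
  (∀ {p} → p ∈ steps w′ → ∃ λ q → q ∈ steps w × q ∼ p) →
  edgeSet w ≡ edgeSet w′
edgeSet-cong {n} {w} {w′} to from = List.filter-≐ _ _ (half w w′ to , half w′ w from) (allEdges n)
  where
  half : ∀ (w w′ : List (Fin n)) → (∀ {p} → p ∈ steps w → ∃ λ q → q ∈ steps w′ × q ∼ p) →
    ∀ {e} → (e ∈ steps w ⊎ swap e ∈ steps w) → (e ∈ steps w′ ⊎ swap e ∈ steps w′)
  half _ _ f (inj₁ e∈) with f e∈
  ... | _ , q∈ , inj₁ refl = inj₁ q∈
  ... | _ , q∈ , inj₂ refl = inj₂ q∈
  half _ _ f (inj₂ e∈) with f e∈
  ... | _ , q∈ , inj₁ refl = inj₂ q∈
  ... | _ , q∈ , inj₂ refl = inj₁ q∈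

-- Walks

-- The steps of the walk from u through vs to z. By computation,
-- steps (v ∷ vs) is walk v vs v and steps (z ∷ u ∷ vs) is (z , u) ∷ walk u vs z.
walk : ∀ {n} → Fin n → List (Fin n) → Fin n → List (Fin n × Fin n)
walk u vs z = zip (u ∷ vs) (vs ∷ʳ z)

-- The vertex reached by the first step of a walk through vs to z.
next : ∀ {n} → List (Fin n) → Fin n → Fin n
next []      z = z
next (v ∷ _) z = v

module _ {n : ℕ} where

  private
    V = Fin n

  walk-source : ∀ {u z x y : V} vs → (x , y) ∈ walk u vs z → x ∈ u ∷ vs
  walk-source [] (here refl) = here refl
  walk-source (v ∷ vs) (here refl) = here refl
  walk-source (v ∷ vs) (there xy∈) = there (walk-source vs xy∈)

  walk-target : ∀ {u z x y : V} vs → (x , y) ∈ walk u vs z → y ∈ z ∷ vs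
  walk-target [] (here refl) = here refl
  walk-target (v ∷ vs) (here refl) = there (here refl)
  walk-target (v ∷ vs) (there xy∈) with walk-target vs xy∈
  ... | here refl = here refl
  ... | there y∈ = there (there y∈)

  -- If the starting vertex is not revisited, only the first step leaves it.
  walk-first : ∀ {u z y : V} vs → u ∉ vs → (u , y) ∈ walk u vs z → y ≡ next vs z
  walk-first [] _ (here refl) = refl
  walk-first (v ∷ vs) _ (here refl) = refl
  walk-first (v ∷ vs) u∉ (there uy∈) = contradiction (walk-source vs uy∈) u∉

  walk-++ : ∀ (u : V) us v vs z → walk u (us ++ v ∷ vs) z ≡ walk u us v ++ walk v vs z
  walk-++ u [] v vs z = refl
  walk-++ u (x ∷ us) v vs z = cong ((u , x) ∷_) (walk-++ x us v vs z)

  crossing-step : ∀ (s : V → Bool) u vs z → s u ≢ s z →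
    ∃₂ λ x y → (x , y) ∈ walk u vs z × s x ≢ s y
  crossing-step s u [] z su≢sz = u , z , here refl , su≢sz
  crossing-step s u (v ∷ vs) z su≢sz with s u Bool.≟ s v
  ... | no su≢sv = u , v , here refl , su≢sv
  ... | yes su≡sv with crossing-step s v vs z (su≢sz ∘ trans su≡sv)
  ...   | x , y , xy∈ , sx≢sy = x , y , there xy∈ , sx≢sy

  -- Paths with at least one step: no vertex is repeated and the ends differ.
  -- The target is listed first, so that an edge from z back to u closes the
  -- cycle z ∷ u ∷ vs without rearranging lists.
  Path : Rel V 0ℓ → V → V → Set
  Path R u z = ∃ λ vs → Unique (z ∷ u ∷ vs) × All (uncurry R) (walk u vs z)

  module _ {R : Rel V 0ℓ} where

    walk⇒star : ∀ u vs z → All (uncurry R) (walk u vs z) → Star R u z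
    walk⇒star u [] z (r ∷ []) = r ◅ ε
    walk⇒star u (v ∷ vs) z (r ∷ rs) = r ◅ walk⇒star v vs z rs

    private
      suffix : ∀ {u w z} vs → u ∈ w ∷ vs → Unique (z ∷ w ∷ vs) →
        All (uncurry R) (walk w vs z) → Path R u z
      suffix vs (here refl) uniq rs = vs , uniq , rs
      suffix (v ∷ vs) (there u∈) ((_ ∷ z≢) ∷ (_ ∷ uniq)) (_ ∷ rs) = suffix vs u∈ (z≢ ∷ uniq) rs

    loopErase : ∀ {u z} → Star R u z → u ≡ z ⊎ Path R u z
    loopErase ε = inj₁ refl
    loopErase {u} {z} (_◅_ {j = w} r rest) with u Fin.≟ z
    ... | yes u≡z = inj₁ u≡z
    ... | no u≢z with loopErase rest
    ...   | inj₁ refl = inj₂ ([] , ((u≢z ∘ sym) ∷ []) ∷ ([] ∷ []) , r ∷ [])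
    ...   | inj₂ (vs , uniq@(z≢ ∷ uniq′) , rs) with DecMembership._∈?_ Fin._≟_ u (w ∷ vs)
    ...     | yes u∈ = inj₂ (suffix vs u∈ uniq rs)
    ...     | no u∉ = inj₂ (w ∷ vs , ((u≢z ∘ sym) ∷ z≢) ∷ (All.¬Any⇒All¬ _ u∉ ∷ uniq′) , r ∷ rs)

  -- The words of length at most n.
  allWords : List (List V)
  allWords = concatMap (words n) (upTo (suc n))

  ∈-words : ∀ (w : List V) → w ∈ words n (length w)
  ∈-words [] = here refl
  ∈-words (v ∷ w) = ∈-cartesianProductWith⁺ _∷_ (∈-allFin v) (∈-words w)

  ∈-allWords : ∀ (w : List V) → length w ≤ n → w ∈ allWords
  ∈-allWords w w≤n = ∈-concatMap⁺ (words n) (lose (∈-upTo⁺ (s≤s w≤n)) (∈-words w))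

  -- A connected pair is joined by a repetition-free walk, so reachability is
  -- decided by searching allWords.
  star? : ∀ {R : Rel V 0ℓ} → Decidable R → Decidable (Star R)
  star? {R} R? u z = map′ from to
    (u Fin.≟ z ⊎-dec any? (λ vs → all? (uncurry R?) (walk u vs z)) allWords)
    where
    Joined : Set
    Joined = u ≡ z ⊎ Any (λ vs → All (uncurry R) (walk u vs z)) allWords
    from : Joined → Star R u z
    from (inj₁ refl) = ε
    from (inj₂ some) with find some
    ... | vs , _ , rs = walk⇒star u vs z rs
    to : Star R u z → Joined
    to star with loopErase star
    ... | inj₁ u≡z = inj₁ u≡z
    ... | inj₂ (vs , _ ∷ (_ ∷ uniq) , rs) = inj₂ (lose (∈-allWords vs (unique⇒length≤ uniq)) rs)

-- Rotating a closed walk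

  unique-resp-↭ : ∀ {xs ys : List V} → xs ↭ ys → Unique xs → Unique ys
  unique-resp-↭ xs↭ys = PermSetoid.Unique-resp-↭ (setoid V) (↭⇒↭ₛ xs↭ys)

  -- A closed walk may be started at any of its vertices; its steps are only
  -- permuted.
  rotate : ∀ {x : V} (w : List V) → x ∈ w → ∃ λ vs → w ↭ x ∷ vs × steps w ↭ walk x vs x
  rotate (v ∷ vs) (here refl) = vs , ↭-refl , ↭-refl
  rotate {x} (v ∷ vs) (there x∈) with ∈-∃++ x∈
  ... | as , bs , refl = bs ++ v ∷ as , Perm.++-comm (v ∷ as) (x ∷ bs) ,
    ↭-trans (↭-reflexive (walk-++ v as x bs v))
    (↭-trans (Perm.++-comm (walk v as x) (walk x bs v))
    (↭-reflexive (sym (walk-++ x bs v as x))))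

  -- A cycle may be started with any of its steps. As it has at least three
  -- vertices, the remaining walk has an inner vertex.
  rotateStep : ∀ {x y : V} w → 3 ≤ length w → Unique w → (x , y) ∈ steps w →
    ∃ λ vs → vs ≢ [] × Unique (x ∷ y ∷ vs) × steps w ↭ (x , y) ∷ walk y vs x
  rotateStep {x} {y} w@(v ∷ us) 3≤ uniq xy∈ with rotate w (walk-source us xy∈)
  ... | vs , w↭ , steps↭
    with unique-resp-↭ w↭ uniq | Perm.↭-length w↭ | Perm.∈-resp-↭ steps↭ xy∈
  ... | uniq′ | len | xy∈′ with subst (3 ≤_) len 3≤
  rotateStep {x} {y} w@(v ∷ us) 3≤ uniq xy∈ | (a ∷ b ∷ vs) , w↭ , steps↭
      | uniq′@(x≢ ∷ _) | len | xy∈′ | s≤s (s≤s (s≤s _))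
      with walk-first (a ∷ b ∷ vs) (All.All¬⇒¬Any x≢) xy∈′
  ...   | refl = b ∷ vs , (λ ()) , uniq′ , steps↭

-- Cuts

-- A two-colouring of the vertices which the tree edge ab separates and which
-- is constant along every other edge of T: the fundamental cut of ab.
record Cut {n} (T : Graph n) (a b : Fin n) : Set where
  field
    side      : Fin n → Bool
    separates : side a ≢ side b
    only      : ∀ {x y} → Adj T x y → side x ≢ side y → (x , y) ∼ (a , b)

  Crosses : Edge n → Set
  Crosses (x , y) = side x ≢ side y

  Crosses-∼ : ∀ {e f} → e ∼ f → Crosses e → Crosses f
  Crosses-∼ (inj₁ refl) c = c
  Crosses-∼ (inj₂ refl) c = c ∘ sym

open Cut public

flip-cut : ∀ {n} {T : Graph n} {a b} → Cut T a b → Cut T b a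
flip-cut κ = record { side = side κ ; separates = separates κ ∘ sym
  ; only = λ xy s → ∼-trans (only κ xy s) (inj₂ refl) }

module _ {n} (T : Graph n) where

  -- In an acyclic graph the ends of a path with an inner vertex are not adjacent.
  chord∉tree : ∀ {u z : Fin n} vs → Acyclic T → vs ≢ [] → Unique (z ∷ u ∷ vs) →
    All (uncurry (Adj T)) (walk u vs z) → ¬ Adj T z u
  chord∉tree [] _ ne = contradiction refl ne
  chord∉tree (_ ∷ _) acyclic _ uniq rs zu = acyclic _ (s≤s (s≤s (s≤s z≤n)) , uniq , zu ∷ rs)

  -- Every edge ab of an acyclic graph has a cut: colour the vertices by whether
  -- they are reachable from a without using ab. The colouring itself is never
  -- computed, only the properties recorded in Cut are used.
  abstract
    cut : Acyclic T → ∀ {a b} → Adj T a b → Cut T a b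
    cut acyclic {a} {b} ab = record
      { side = s
      ; separates = λ sa≡sb → b∉
          (reached (star? R? a b) (trans (sym sa≡sb) (dec-true (star? R? a a) ε)))
      ; only = λ {x} {y} xy sx≢sy →
          decidable-stable ((x , y) ∼? (a , b)) λ xy≁ → sx≢sy (same xy xy≁)
      }
      where
      R : Rel (Fin n) 0ℓ
      R x y = Adj T x y × ¬ (x , y) ∼ (a , b)
      R? : Decidable R
      R? x y = adj? T x y ×-dec ¬? ((x , y) ∼? (a , b))
      s : Fin n → Bool
      s x = does (star? R? a x)
      reached : ∀ {A : Set} (a? : Dec A) → does a? ≡ true → A
      reached (yes p) _ = p
      R-sym : ∀ {x y} → R x y → R y x
      R-sym (xy , xy≁) = adj-sym T xy , xy≁ ∘ ∼-trans (inj₂ refl)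
      same : ∀ {x y} → Adj T x y → ¬ (x , y) ∼ (a , b) → s x ≡ s y
      same xy xy≁ = does-⇔ (mk⇔ (_◅◅ (xy , xy≁) ◅ ε) (_◅◅ R-sym (xy , xy≁) ◅ ε))
        (star? R? a _) (star? R? a _)
      b∉ : ¬ Star R a b
      b∉ star with loopErase star
      ... | inj₁ a≡b = adj-irrefl T a≡b ab
      ... | inj₂ ([] , _ , (_ , ab≁) ∷ []) = ab≁ (inj₁ refl)
      ... | inj₂ (vs@(_ ∷ _) , uniq , rs) =
        chord∉tree vs acyclic (λ ()) uniq (All.map proj₁ rs) (adj-sym T ab)

-- Tree edges and cycle-edges

module _ {n} (T : Graph n) where

  Adj-∼ : ∀ {e f} → e ∼ f → uncurry (Adj T) e → uncurry (Adj T) f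
  Adj-∼ (inj₁ refl) uv = uv
  Adj-∼ (inj₂ refl) uv = adj-sym T uv

  Adj⇒≢ : ∀ {u v} → Adj T u v → u ≢ v
  Adj⇒≢ uv u≡v = adj-irrefl T u≡v uv

  ∈-edges⁺ : ∀ {u v} → Adj T u v → orient u v ∈ edges T
  ∈-edges⁺ {u} {v} uv = ∈-filter⁺ _ (orient-∈ (Adj⇒≢ uv)) (Adj-∼ (∼-sym (orient-∼ u v)) uv)

  ∈-edges⁻ : ∀ {e} → e ∈ edges T → e ∈ allEdges n × uncurry (Adj T) e
  ∈-edges⁻ = ∈-filter⁻ (uncurry (adj? T)) {xs = allEdges n}

  ∈-cycleEdges⁺ : ∀ {e} → e ∈ allEdges n → ¬ uncurry (Adj T) e → e ∈ cycleEdges (K n) T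
  ∈-cycleEdges⁺ e∈ ¬e = ∈-filter⁺ _ (∈-filter⁺ _ e∈ (∈-allEdges⇒≢ e∈)) ¬e

  ∈-cycleEdges⁻ : ∀ {e} → e ∈ cycleEdges (K n) T → e ∈ allEdges n × ¬ uncurry (Adj T) e
  ∈-cycleEdges⁻ e∈ with ∈-filter⁻ _ {xs = edges (K n)} e∈
  ... | e∈K , ¬e = proj₁ (∈-filter⁻ _ {xs = allEdges n} e∈K) , ¬e

  orient-∈-cycleEdges : ∀ {u v} → u ≢ v → ¬ Adj T u v → orient u v ∈ cycleEdges (K n) T
  orient-∈-cycleEdges {u} {v} u≢v ¬uv = ∈-cycleEdges⁺ (orient-∈ u≢v) (¬uv ∘ Adj-∼ (orient-∼ u v))

  cycleEdges-unique : Unique (cycleEdges (K n) T)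
  cycleEdges-unique = Unique.filter⁺ _ (Unique.filter⁺ _ (allEdges-unique n))

-- Tree-cycles

-- c is the edge set of a cycle in T ∪ e. The lower
-- bound does not use that this cycle is unique.
IsTreeCycle : ∀ {n} → Graph n → Edge n → EdgeSet n → Set
IsTreeCycle T e c = ∃ λ w → IsCycle (AdjWith T e) w × c ≡ edgeSet w

module _ {n} (T : Graph n) where

  ∈-treeCycles⁺ : ∀ {e c} → e ∈ cycleEdges (K n) T → IsTreeCycle T e c → c ∈ treeCycles (K n) T
  ∈-treeCycles⁺ {e} e∈ (w , cyc@(_ , uniq , _) , refl) = ∈-deduplicate⁺ _≟ˢ_
    (∈-concatMap⁺ (map edgeSet ∘ cyclesWith T)
      (lose e∈ (∈-map⁺ edgeSet
        (∈-filter⁺ (isCycle? (adjWith? T e)) (∈-allWords w (unique⇒length≤ uniq)) cyc))))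

  ∈-treeCycles⁻ : ∀ {c} → c ∈ treeCycles (K n) T →
    ∃ λ e → e ∈ cycleEdges (K n) T × IsTreeCycle T e c
  ∈-treeCycles⁻ c∈ with find (∈-concatMap⁻ (map edgeSet ∘ cyclesWith T)
    (∈-deduplicate⁻ _≟ˢ_ (concatMap (map edgeSet ∘ cyclesWith T) (cycleEdges (K n) T)) c∈))
  ... | e , e∈ , c∈e with ∈-map⁻ edgeSet c∈e
  ... | w , w∈ , c≡ = e , e∈ , w ,
    proj₂ (∈-filter⁻ (isCycle? (adjWith? T e)) {xs = allWords} w∈) , c≡

  treeCycles-unique : Unique (treeCycles (K n) T)
  treeCycles-unique = DecUnique.deduplicate-! _≟ˢ_ _

  module _ (acyclic : Acyclic T) where

    -- A cycle of T ∪ e uses e, because T is acyclic. Started there, it runs through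
    -- T for the rest of the way, since e cannot be used twice.
    cycle-through : ∀ {e w} → ¬ uncurry (Adj T) e → IsCycle (AdjWith T e) w →
      ∃ λ x → ∃ λ y → ∃ λ vs → (x , y) ∼ e × vs ≢ [] × Unique (x ∷ y ∷ vs) ×
        All (uncurry (Adj T)) (walk y vs x) × steps w ↭ (x , y) ∷ walk y vs x
    cycle-through {e} {w} ¬e (3≤ , uniq , rs) with any? (_∼? e) (steps w)
    ... | no none = contradiction (3≤ , uniq , All.tabulate inTree) (acyclic w)
      where
      inTree : ∀ {p} → p ∈ steps w → uncurry (Adj T) p
      inTree p∈ with All.lookup rs p∈
      ... | inj₁ p = p
      ... | inj₂ p∼e = contradiction (lose p∈ p∼e) none
    ... | yes some with find some
    ...   | (x , y) , xy∈ , xy∼e with rotateStep w 3≤ uniq xy∈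
    ...     | vs , vs≢[] , uniq′@((x≢y ∷ x≢vs) ∷ (y≢vs ∷ _)) , steps↭ =
      x , y , vs , xy∼e , vs≢[] , uniq′ , All.tabulate inTree , steps↭
      where
      next-≢ : ∀ us → us ≢ [] → All (x ≢_) us → next us x ≢ x
      next-≢ [] ne = contradiction refl ne
      next-≢ (u ∷ us) _ (x≢u ∷ _) = x≢u ∘ sym
      elsewhere : ∀ {p} → p ∈ walk y vs x → ¬ p ∼ (x , y)
      elsewhere p∈ (inj₁ refl) with walk-source vs p∈
      ... | here x≡y = x≢y x≡y
      ... | there x∈ = ∈⇒≢ x≢vs x∈ refl
      elsewhere p∈ (inj₂ refl) =
        next-≢ vs vs≢[] x≢vs (sym (walk-first vs (All.All¬⇒¬Any y≢vs) p∈))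
      inTree : ∀ {p} → p ∈ walk y vs x → uncurry (Adj T) p
      inTree p∈ with All.lookup rs (Perm.∈-resp-↭ (↭-sym steps↭) (there p∈))
      ... | inj₁ p = p
      ... | inj₂ p∼e = contradiction (∼-trans p∼e (∼-sym xy∼e)) (elsewhere p∈)

    -- If e crosses the cut of the tree edge ab, then every tree-cycle of e contains
    -- ab: the part of the cycle inside T has to return across the cut.
    crosses⇒∈ : ∀ {e c a b} → ¬ uncurry (Adj T) e → IsTreeCycle T e c →
      Adj T a b → (κ : Cut T a b) → Crosses κ e → orient a b ∈ c
    crosses⇒∈ {a = a} {b} ¬e (w , cyc , refl) ab κ eκ with cycle-through ¬e cyc
    ... | x , y , vs , xy∼e , _ , _ , rs , steps↭
      with crossing-step (side κ) y vs x (Crosses-∼ κ (∼-sym xy∼e) eκ ∘ sym)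
    ... | u , v , uv∈ , su≢sv =
      edgeSet-∈⁺ {w = w} (orient-∈ (Adj⇒≢ T ab)) (Perm.∈-resp-↭ (↭-sym steps↭) (there uv∈))
        (∼-trans (only κ (All.lookup rs uv∈) su≢sv) (∼-sym (orient-∼ a b)))

    -- The only edge outside T in a tree-cycle of e is e itself.
    treeCycle-injective : ∀ {e f c} → e ∈ cycleEdges (K n) T → f ∈ cycleEdges (K n) T →
      IsTreeCycle T e c → IsTreeCycle T f c → e ≡ f
    treeCycle-injective {e} {f} e∈ f∈ (w , cyc , refl) (w′ , (_ , _ , rs) , c≡)
      with ∈-cycleEdges⁻ T e∈ | ∈-cycleEdges⁻ T f∈
    ... | e∈K , ¬e | f∈K , _ with cycle-through ¬e cyc
    ... | x , y , vs , xy∼e , _ , _ , _ , steps↭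
      with edgeSet-∈⁻ {w = w′} (subst (e ∈_) c≡
        (edgeSet-∈⁺ {w = w} e∈K (Perm.∈-resp-↭ (↭-sym steps↭) (here refl)) xy∼e))
    ... | _ , p , p∈ , p∼e with All.lookup rs p∈
    ... | inj₁ p∈T = contradiction (Adj-∼ T p∼e p∈T) ¬e
    ... | inj₂ p∼f = ∼⇒≡ e∈K f∈K (∼-trans (∼-sym p∼e) p∼f)

-- Counting tree-cycles in a spanning tree

module SpanningTree {n} {T : Graph n} (tree : IsSpanningTree (K n) T) where

  open IsSpanningTree tree public

  -- A tree-cycle of the cycle-edge ab, closing up a path of T from a to b. The
  -- empty value is never reached for cycle-edges.
  cycleOf : Edge n → EdgeSet n
  cycleOf (a , b) with loopErase (connected a b)
  ... | inj₁ _ = []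
  ... | inj₂ (vs , _) = edgeSet (b ∷ a ∷ vs)

  cycleOf-isTreeCycle : ∀ {e} → e ∈ cycleEdges (K n) T → IsTreeCycle T e (cycleOf e)
  cycleOf-isTreeCycle {a , b} e∈ with ∈-cycleEdges⁻ T e∈
  ... | e∈K , ¬ab with loopErase (connected a b)
  ...   | inj₁ a≡b = contradiction a≡b (∈-allEdges⇒≢ e∈K)
  ...   | inj₂ ([] , _ , ab ∷ []) = contradiction ab ¬ab
  ...   | inj₂ (vs@(_ ∷ _) , uniq , rs) = b ∷ a ∷ vs ,
    (s≤s (s≤s (s≤s z≤n)) , uniq , inj₂ (inj₂ refl) ∷ All.map inj₁ rs) , refl

  cycleOf-injective : ∀ {e f} → e ∈ cycleEdges (K n) T → f ∈ cycleEdges (K n) T →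
    cycleOf e ≡ cycleOf f → e ≡ f
  cycleOf-injective e∈ f∈ eq = treeCycle-injective T acyclic e∈ f∈ (cycleOf-isTreeCycle e∈)
    (subst (IsTreeCycle T _) (sym eq) (cycleOf-isTreeCycle f∈))

  -- Two edges crossing the cut of a common tree edge.
  Linked : Edge n → Edge n → Set
  Linked e f = ∃₂ λ a b → Adj T a b × (∃ λ (κ : Cut T a b) → Crosses κ e × Crosses κ f)

  linked⇒intersect : ∀ {e f c d} → ¬ uncurry (Adj T) e → ¬ uncurry (Adj T) f →
    IsTreeCycle T e c → IsTreeCycle T f d → Linked e f → Intersect T c d
  linked⇒intersect ¬e ¬f ec fd (a , b , ab , κ , eκ , fκ) =
    lose (crosses⇒∈ T acyclic ¬e ec ab κ eκ) (crosses⇒∈ T acyclic ¬f fd ab κ fκ , ∈-edges⁺ T ab)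

  -- Let M be a repetition-free list of edges which are cycle-edges linked to e,
  -- except for those in a list X containing e. Each edge of M outside X contributes
  -- a tree-cycle of its own that meets a given tree-cycle c of e.
  linked-bound : ∀ {e c} (M X : List (Edge n)) → e ∈ cycleEdges (K n) T → IsTreeCycle T e c →
    Unique M → e ∈ X →
    (∀ {f} → f ∈ M → f ∉ X → f ∈ cycleEdges (K n) T × Linked e f) →
    length M ≤ length X + cycleIntersectionNumber (K n) T c
  linked-bound {e} {c} M X e∈ ec uniq e∈X good = ℕ.≤-trans
    (ℕ.≤-trans (unique-⊆⇒length≤ uniq cover) (ℕ.≤-reflexive (List.length-++ X)))
    (ℕ.+-monoʳ-≤ (length X) (ℕ.≤-trans (ℕ.≤-reflexive (sym (List.length-map cycleOf M′)))
      (unique-⊆⇒length≤ (unique-map cycleOf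
        (λ f∈ g∈ → cycleOf-injective (proj₁ (good′ f∈)) (proj₁ (good′ g∈)))
        (Unique.filter⁺ _ uniq)) into)))
    where
    M′ = filter (λ f → ¬? (f ∈? X)) M
    split : ∀ {f} → f ∈ M′ → f ∈ M × f ∉ X
    split = ∈-filter⁻ (λ f → ¬? (f ∈? X)) {xs = M}
    good′ : ∀ {f} → f ∈ M′ → f ∈ cycleEdges (K n) T × Linked e f
    good′ f∈ = uncurry good (split f∈)
    cover : M ⊆ X ++ M′
    cover {f} f∈ with f ∈? X
    ... | yes f∈X = ∈-++⁺ˡ f∈X
    ... | no f∉X = ∈-++⁺ʳ X (∈-filter⁺ _ f∈ f∉X)
    into : map cycleOf M′ ⊆
      filter (λ c′ → ¬? (c′ ≟ˢ c) ×-dec intersect? T c c′) (treeCycles (K n) T)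
    into d∈ with ∈-map⁻ cycleOf d∈
    ... | f , f∈ , refl with good′ f∈
    ... | f∈C , link = ∈-filter⁺ _ (∈-treeCycles⁺ T f∈C fd)
      ((λ d≡c → proj₂ (split f∈) (subst (_∈ X) (e≡f d≡c) e∈X)) ,
       linked⇒intersect (proj₂ (∈-cycleEdges⁻ T e∈)) (proj₂ (∈-cycleEdges⁻ T f∈C)) ec fd link)
      where
      fd = cycleOf-isTreeCycle f∈C
      e≡f : cycleOf f ≡ c → e ≡ f
      e≡f d≡c = treeCycle-injective T acyclic e∈ f∈C ec (subst (IsTreeCycle T f) d≡c fd)

  cycleEdges≤treeCycles : length (cycleEdges (K n) T) ≤ length (treeCycles (K n) T)
  cycleEdges≤treeCycles = ℕ.≤-trans
    (ℕ.≤-reflexive (sym (List.length-map cycleOf (cycleEdges (K n) T))))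
    (unique-⊆⇒length≤ (unique-map cycleOf cycleOf-injective (cycleEdges-unique T)) into)
    where
    into : map cycleOf (cycleEdges (K n) T) ⊆ treeCycles (K n) T
    into c∈ with ∈-map⁻ cycleOf c∈
    ... | e , e∈ , refl = ∈-treeCycles⁺ T e∈ (cycleOf-isTreeCycle e∈)

-- A spanning tree on k + 1 vertices has at most k edges. Root it at zero and let
-- the parent of a vertex be its successor on a path to the root: every tree edge
-- joins a vertex to its parent, namely the end cut off from the root.
allEdges≤ : ∀ {k} {T : Graph (suc k)} → IsSpanningTree (K (suc k)) T →
  length (allEdges (suc k)) ≤ length (cycleEdges (K (suc k)) T) + k
allEdges≤ {k} {T} tree = ℕ.≤-trans (unique-⊆⇒length≤ (allEdges-unique (suc k)) cover)
  (ℕ.≤-reflexive (trans (List.length-++ (cycleEdges (K (suc k)) T))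
    (cong (length (cycleEdges (K (suc k)) T) +_)
      (trans (List.length-map parentEdge (allFin k)) (length-allFin k)))))
  where
  open SpanningTree tree
  parent : Fin k → Fin (suc k)
  parent i with loopErase (connected (suc i) zero)
  ... | inj₂ (vs , _) = next vs zero
  parentEdge : Fin k → Edge (suc k)
  parentEdge i = orient (suc i) (parent i)
  parent-unique : ∀ i {b} → (κ : Cut T (suc i) b) →
    side κ (suc i) ≢ side κ zero → parent i ≡ b
  parent-unique i {b} κ s≢ with loopErase (connected (suc i) zero)
  ... | inj₂ (vs , (0≢i ∷ 0≢vs) ∷ (i≢vs ∷ _) , rs) with crossing-step (side κ) (suc i) vs zero s≢
  ... | x , y , xy∈ , sx≢sy with only κ (All.lookup rs xy∈) sx≢sy
  ... | inj₁ refl = sym (walk-first vs (All.All¬⇒¬Any i≢vs) xy∈)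
  ... | inj₂ refl with walk-target vs xy∈
  ...   | there i∈ = contradiction refl (∈⇒≢ i≢vs i∈)
  isParentEdge : ∀ i {b} → Adj T (suc i) b → (κ : Cut T (suc i) b) →
    side κ (suc i) ≢ side κ zero →
    ∀ {e} → e ∈ allEdges (suc k) → (suc i , b) ∼ e → e ∈ map parentEdge (allFin k)
  isParentEdge i ab κ s≢ e∈ ∼e = subst (_∈ map parentEdge (allFin k))
    (orient-≡ (λ eq → Adj⇒≢ T ab (trans eq (parent-unique i κ s≢))) e∈
      (subst (λ b → (suc i , b) ∼ _) (sym (parent-unique i κ s≢)) ∼e))
    (∈-map⁺ parentEdge (∈-allFin i))
  cover : allEdges (suc k) ⊆ cycleEdges (K (suc k)) T ++ map parentEdge (allFin k)
  cover {a , b} e∈ with adj? T a b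
  ... | no ¬ab = ∈-++⁺ˡ (∈-cycleEdges⁺ T e∈ ¬ab)
  ... | yes ab = ∈-++⁺ʳ (cycleEdges (K (suc k)) T)
    (child (side κ a Bool.≟ side κ zero) (side κ b Bool.≟ side κ zero))
    where
    κ = cut T acyclic ab
    child : Dec (side κ a ≡ side κ zero) → Dec (side κ b ≡ side κ zero) →
      (a , b) ∈ map parentEdge (allFin k)
    child (yes a≡) (yes b≡) = contradiction (trans a≡ (sym b≡)) (separates κ)
    child (no a≢) _ = below a refl a≢
      where
      below : ∀ a′ → a′ ≡ a → side κ a ≢ side κ zero → (a , b) ∈ map parentEdge (allFin k)
      below zero refl a≢ = contradiction refl a≢
      below (suc i) refl a≢ = isParentEdge i ab κ a≢ e∈ (inj₁ refl)
    child (yes _) (no b≢) = below b refl b≢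
      where
      below : ∀ b′ → b′ ≡ b → side κ b ≢ side κ zero → (a , b) ∈ map parentEdge (allFin k)
      below zero refl b≢ = contradiction refl b≢
      below (suc i) refl b≢ = isParentEdge i (adj-sym T ab) (flip-cut κ) b≢ e∈ (inj₂ refl)

-- The lower bound for a tree-cycle of a spanning tree

-- There are only two colours.
two-valued : ∀ {a b c} → a ≢ b → c ≢ b → c ≡ a
two-valued a≢b c≢b = trans (Bool.¬-not c≢b) (sym (Bool.¬-not a≢b))

-- This is (p - 2)(q - 2) ≥ 0.
product-bound : ∀ {n} p q → 2 ≤ p → 2 ≤ q → n ≤ p + q → 2 * n ≤ 4 + p * q
product-bound {n} (suc (suc p)) (suc (suc q)) (s≤s (s≤s z≤n)) (s≤s (s≤s z≤n)) n≤ =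
  ℕ.≤-trans (ℕ.*-monoʳ-≤ 2 n≤)
    (ℕ.≤-trans (ℕ.m≤m+n _ (p * q)) (ℕ.≤-reflexive (expand p q)))
  where
  expand : ∀ p q → 2 * ((2 + p) + (2 + q)) + p * q ≡ 4 + (2 + p) * (2 + q)
  expand = solve-∀

module _ {n} {T : Graph n} {a b} (κ : Cut T a b) where

  same-side : ∀ {x y} → Adj T x y → ¬ (x , y) ∼ (a , b) → side κ x ≡ side κ y
  same-side xy xy≁ = decidable-stable (side κ _ Bool.≟ side κ _) (xy≁ ∘ only κ xy)

  crossing-∈-cycleEdges : ∀ {x y} → side κ x ≢ side κ y → orient x y ≢ orient a b →
    a ≢ b → orient x y ∈ cycleEdges (K n) T
  crossing-∈-cycleEdges {x} {y} s≢ ne a≢b = orient-∈-cycleEdges T x≢y λ xy →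
    ne (orient-≡ x≢y (orient-∈ a≢b) (∼-trans (only κ xy s≢) (∼-sym (orient-∼ a b))))
    where
    x≢y : x ≢ y
    x≢y = s≢ ∘ cong (side κ)

  -- The two sides of the cut: that of a and that of b.
  near far : List (Fin n)
  near = filter (λ x → side κ x Bool.≟ side κ a) (allFin n)
  far  = filter (λ x → ¬? (side κ x Bool.≟ side κ a)) (allFin n)

  ∈-near⁻ : ∀ {x} → x ∈ near → side κ x ≡ side κ a
  ∈-near⁻ x∈ = proj₂ (∈-filter⁻ (λ x → side κ x Bool.≟ side κ a) {xs = allFin n} x∈)

  ∈-far⁻ : ∀ {x} → x ∈ far → side κ x ≢ side κ a
  ∈-far⁻ x∈ = proj₂ (∈-filter⁻ (λ x → ¬? (side κ x Bool.≟ side κ a)) {xs = allFin n} x∈)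

  -- All pairs of vertices, including ab, with ends on different sides of the cut.
  crossing : List (Edge n)
  crossing = map (uncurry orient) (cartesianProduct near far)

  ∈-crossing⁻ : ∀ {f} → f ∈ crossing →
    ∃₂ λ x y → f ≡ orient x y × side κ x ≡ side κ a × side κ y ≢ side κ a
  ∈-crossing⁻ f∈ with ∈-map⁻ (uncurry orient) f∈
  ... | (x , y) , xy∈ , f≡ with ∈-cartesianProduct⁻ near far xy∈
  ...   | x∈ , y∈ = x , y , f≡ , ∈-near⁻ x∈ , ∈-far⁻ y∈

  crossing-unique : Unique crossing
  crossing-unique = unique-map (uncurry orient) inj
    (Unique.cartesianProduct⁺ (Unique.filter⁺ _ (Unique.allFin⁺ n))
      (Unique.filter⁺ _ (Unique.allFin⁺ n)))
    where
    inj : ∀ {p q} → p ∈ cartesianProduct near far → q ∈ cartesianProduct near far →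
      uncurry orient p ≡ uncurry orient q → p ≡ q
    inj p∈ q∈ eq with orient-injective eq
    ... | inj₁ p≡q = p≡q
    ... | inj₂ refl = contradiction (∈-near⁻ (proj₁ (∈-cartesianProduct⁻ near far p∈)))
      (∈-far⁻ (proj₂ (∈-cartesianProduct⁻ near far q∈)))

  length-crossing : ∀ {a′ b′} → a′ ≢ a → side κ a′ ≡ side κ a → b′ ≢ b → side κ b′ ≡ side κ b →
    2 * n ≤ 4 + length crossing
  length-crossing {a′} {b′} a′≢a a′≡ b′≢b b′≡ = subst (λ l → 2 * n ≤ 4 + l)
    (sym (trans (List.length-map (uncurry orient) (cartesianProduct near far))
      (length-cartesianProduct near far)))
    (product-bound (length near) (length far)
      (unique-⊆⇒length≤ {xs = a ∷ a′ ∷ []} (((a′≢a ∘ sym) ∷ []) ∷ [] ∷ []) λ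
        { (here refl) → ∈-filter⁺ _ (∈-allFin _) refl
        ; (there (here refl)) → ∈-filter⁺ _ (∈-allFin _) a′≡ })
      (unique-⊆⇒length≤ {xs = b ∷ b′ ∷ []} (((b′≢b ∘ sym) ∷ []) ∷ [] ∷ []) λ
        { (here refl) → ∈-filter⁺ _ (∈-allFin _) (separates κ ∘ sym)
        ; (there (here refl)) → ∈-filter⁺ _ (∈-allFin _)
            (λ eq → separates κ (trans (sym eq) b′≡)) })
      (subst₂ _≤_ (length-allFin n) (List.length-++ near)
        (unique-⊆⇒length≤ (Unique.allFin⁺ n) cover)))
    where
    cover : allFin n ⊆ near ++ far
    cover {x} x∈ with side κ x Bool.≟ side κ a
    ... | yes eq = ∈-++⁺ˡ (∈-filter⁺ _ x∈ eq)
    ... | no ne = ∈-++⁺ʳ near (∈-filter⁺ _ x∈ ne)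

module TreeBounds {n} {T : Graph n} (tree : IsSpanningTree (K n) T) where

  open SpanningTree tree

  -- Cycle intersection numbers in T.
  -- The bounds below are stated as 2 * n ≤ 6 + cap c, that is, 2 (n - 3) ≤ cap c.
  cap : EdgeSet n → ℕ
  cap = cycleIntersectionNumber (K n) T

  -- If both sides of the cut of ab have at least two vertices, then the pairs
  -- crossing it, other than ab and e, already suffice. The list H collects further
  -- cycle-edges linked to e in some other way.
  internal-bound : ∀ {a b a′ b′ e c} (κ : Cut T a b) → Adj T a b →
    a′ ≢ a → side κ a′ ≡ side κ a → b′ ≢ b → side κ b′ ≡ side κ b →
    e ∈ cycleEdges (K n) T → IsTreeCycle T e c → Crosses κ e →
    (H : List (Edge n)) → Unique H →
    (∀ {h} → h ∈ H → h ∈ cycleEdges (K n) T × Linked e h × ¬ Crosses κ h) →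
    length H + 2 * n ≤ 6 + cap c
  internal-bound {a} {b} {a′} {b′} {e} {c} κ ab a′≢a a′≡ b′≢b b′≡ e∈ ec eκ H uniq extra = begin
    length H + 2 * n
      ≤⟨ ℕ.+-monoʳ-≤ (length H) (length-crossing κ a′≢a a′≡ b′≢b b′≡) ⟩
    length H + (4 + length (crossing κ))
      ≡⟨ rearrange (length H) (length (crossing κ)) ⟩
    4 + (length H + length (crossing κ))
      ≡⟨ cong (4 +_) (sym (List.length-++ H)) ⟩
    4 + length (H ++ crossing κ)
      ≤⟨ ℕ.+-monoʳ-≤ 4 (linked-bound (H ++ crossing κ) (e ∷ orient a b ∷ []) e∈ ec
           (Unique.++⁺ uniq (crossing-unique κ)
             (λ (h∈ , h∈′) → proj₂ (proj₂ (extra h∈)) (crosses h∈′)))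
           (here refl) good) ⟩
    6 + cap c ∎
    where
    open ℕ.≤-Reasoning
    rearrange : ∀ h m → h + (4 + m) ≡ 4 + (h + m)
    rearrange = solve-∀
    crosses : ∀ {f} → f ∈ crossing κ → Crosses κ f
    crosses f∈ with ∈-crossing⁻ κ f∈
    ... | x , y , refl , x≡ , y≢ =
      Crosses-∼ κ (∼-sym (orient-∼ x y)) (λ eq → y≢ (trans (sym eq) x≡))
    good : ∀ {f} → f ∈ H ++ crossing κ → f ∉ e ∷ orient a b ∷ [] →
      f ∈ cycleEdges (K n) T × Linked e f
    good f∈ f∉ with ∈-++⁻ H f∈
    ... | inj₁ f∈H = proj₁ (extra f∈H) , proj₁ (proj₂ (extra f∈H))
    ... | inj₂ f∈C with ∈-crossing⁻ κ f∈C
    ...   | x , y , refl , x≡ , y≢ =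
      crossing-∈-cycleEdges κ (λ eq → y≢ (trans (sym eq) x≡)) (f∉ ∘ there ∘ here) (Adj⇒≢ T ab) ,
      a , b , ab , κ , eκ , crosses f∈C

  -- The first edge on the tree path from x to y separates x from y.
  first-edge : ∀ {x y} → x ≢ y → ∃ λ p → Adj T x p × (∃ λ (κ : Cut T x p) → side κ x ≢ side κ y)
  first-edge {x} {y} x≢y with loopErase (connected x y)
  ... | inj₁ x≡y = contradiction x≡y x≢y
  ... | inj₂ ([] , _ , xy ∷ []) = y , xy , cut T acyclic xy , separates (cut T acyclic xy)
  ... | inj₂ (p ∷ vs , (_ ∷ y≢vs) ∷ (x≢vs ∷ _) , xp ∷ rs) = p , xp , κ , λ x≡y → returns x≡y
    where
    κ = cut T acyclic xp
    returns : side κ x ≢ side κ y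
    returns x≡y with crossing-step (side κ) p vs y (λ p≡y → separates κ (trans x≡y (sym p≡y)))
    ... | u , v , uv∈ , su≢sv with only κ (All.lookup rs uv∈) su≢sv
    ... | inj₁ refl = ∈⇒≢ x≢vs (walk-source vs uv∈) refl
    ... | inj₂ refl with walk-target vs uv∈
    ...   | here x≡y = x≢y x≡y
    ...   | there x∈ = ∈⇒≢ x≢vs (there x∈) refl

  -- The side of a consists of a alone.
  Alone : ∀ {a b} → Cut T a b → Set
  Alone {a} κ = ∀ z → z ≢ a → side κ a ≢ side κ z

  alone? : ∀ {a b} (κ : Cut T a b) → (∃ λ a′ → a′ ≢ a × side κ a′ ≡ side κ a) ⊎ Alone κ
  alone? {a} κ with Fin.any? (λ z → ¬? (z Fin.≟ a) ×-dec (side κ z Bool.≟ side κ a))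
  ... | yes some = inj₁ some
  ... | no none = inj₂ λ z z≢a eq → none (z , z≢a , sym eq)

  -- If x and y are both cut off by a single tree edge, then every pair through x or
  -- y crosses one of the two cuts, which leaves out xy itself and the two tree
  -- edges.
  pendant-bound : ∀ {x y p q c} → Adj T x p → Adj T y q → x ≢ y →
    (κ : Cut T x p) → (μ : Cut T y q) → Alone κ → Alone μ →
    orient x y ∈ cycleEdges (K n) T → IsTreeCycle T (orient x y) c → 2 * n ≤ 6 + cap c
  pendant-bound {x} {y} {p} {q} {c} xp yq x≢y κ μ aloneκ aloneμ e∈ ec = begin
    2 * n
      ≡⟨ double n ⟩
    n + n
      ≤⟨ ℕ.+-mono-≤ (length-others≥ (x ∷ [])) (length-others≥ (x ∷ y ∷ [])) ⟩
    (1 + length (others (x ∷ []))) + (2 + length (others (x ∷ y ∷ [])))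
      ≡⟨ rearrange (length (others (x ∷ []))) (length (others (x ∷ y ∷ []))) ⟩
    3 + (length (others (x ∷ [])) + length (others (x ∷ y ∷ [])))
      ≡⟨ cong (3 +_) (sym (trans (List.length-++ Mx)
           (cong₂ _+_ (List.length-map (orient x) (others (x ∷ [])))
             (List.length-map (orient y) (others (x ∷ y ∷ [])))))) ⟩
    3 + length (Mx ++ My)
      ≤⟨ ℕ.+-monoʳ-≤ 3 (linked-bound (Mx ++ My) X e∈ ec
           (Unique.++⁺ (spokes-unique x (x ∷ [])) (spokes-unique y (x ∷ y ∷ [])) disjoint)
           (here refl) good) ⟩
    6 + cap c ∎
    where
    open ℕ.≤-Reasoning
    double : ∀ m → 2 * m ≡ m + m
    double = solve-∀
    rearrange : ∀ k l → (1 + k) + (2 + l) ≡ 3 + (k + l)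
    rearrange = solve-∀
    X Mx My : List (Edge n)
    X = orient x y ∷ orient x p ∷ orient y q ∷ []
    Mx = map (orient x) (others (x ∷ []))
    My = map (orient y) (others (x ∷ y ∷ []))
    spokes-unique : ∀ u vs → Unique (map (orient u) (others vs))
    spokes-unique u vs = unique-map (orient u) (λ {z} {z′} _ _ eq → inj (orient-injective eq))
      (others-unique vs)
      where
      inj : ∀ {z z′} → (u , z) ∼ (u , z′) → z ≡ z′
      inj (inj₁ refl) = refl
      inj (inj₂ refl) = refl
    disjoint : ∀ {f} → ¬ (f ∈ Mx × f ∈ My)
    disjoint (f∈ , f∈′) with ∈-map⁻ (orient x) f∈ | ∈-map⁻ (orient y) f∈′
    ... | z , z∈ , refl | z′ , z′∈ , eq with orient-injective eq
    ...   | inj₁ refl = x≢y refl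
    ...   | inj₂ refl = ∈-others⁻ (x ∷ y ∷ []) z′∈ (here refl)
    eκ : Crosses κ (orient x y)
    eκ = Crosses-∼ κ (∼-sym (orient-∼ x y)) (aloneκ y (x≢y ∘ sym))
    eμ : Crosses μ (orient x y)
    eμ = Crosses-∼ μ (∼-sym (orient-∼ x y)) (aloneμ x x≢y ∘ sym)
    good : ∀ {f} → f ∈ Mx ++ My → f ∉ X → f ∈ cycleEdges (K n) T × Linked (orient x y) f
    good f∈ f∉ with ∈-++⁻ Mx f∈
    ... | inj₁ f∈x with ∈-map⁻ (orient x) f∈x
    ...   | z , z∈ , refl =
      crossing-∈-cycleEdges κ xz (f∉ ∘ there ∘ here) (Adj⇒≢ T xp) ,
      x , p , xp , κ , eκ , Crosses-∼ κ (∼-sym (orient-∼ x z)) xz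
      where xz = aloneκ z (∈-others⁻ (x ∷ []) z∈ ∘ here)
    good f∈ f∉ | inj₂ f∈y with ∈-map⁻ (orient y) f∈y
    ...   | z , z∈ , refl =
      crossing-∈-cycleEdges μ yz (f∉ ∘ there ∘ there ∘ here) (Adj⇒≢ T yq) ,
      y , q , yq , μ , eμ , Crosses-∼ μ (∼-sym (orient-∼ y z)) yz
      where yz = aloneμ z (∈-others⁻ (x ∷ y ∷ []) z∈ ∘ there ∘ here)

  -- On the far side of the edge xp there are already p and y, so only a second
  -- vertex on the side of x has to be supplied.
  toward-bound : ∀ {x y p a′ c} → ¬ Adj T x y → Adj T x p →
    (κ : Cut T x p) → side κ x ≢ side κ y →
    a′ ≢ x → side κ a′ ≡ side κ x →
    ∀ {e} → (x , y) ∼ e → e ∈ cycleEdges (K n) T → IsTreeCycle T e c → 2 * n ≤ 6 + cap c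
  toward-bound ¬xy xp κ x≢y a′≢x a′≡ xy∼e e∈ ec =
    internal-bound κ xp a′≢x a′≡ (λ { refl → ¬xy xp })
      (two-valued (separates κ ∘ sym) (x≢y ∘ sym)) e∈ ec (Crosses-∼ κ xy∼e x≢y) [] [] λ ()

  cycle-bound : ∀ {c} → c ∈ treeCycles (K n) T → 2 * n ≤ 6 + cap c
  cycle-bound c∈ with ∈-treeCycles⁻ T c∈
  ... | (x , y) , e∈ , ec with ∈-cycleEdges⁻ T e∈
  ... | e∈K , ¬xy with first-edge (∈-allEdges⇒≢ e∈K) | first-edge (∈-allEdges⇒≢ e∈K ∘ sym)
  ... | p , xp , κ , κx≢y | q , yq , μ , μy≢x with alone? κ | alone? μ
  ... | inj₁ (a′ , a′≢x , a′≡) | _ = toward-bound ¬xy xp κ κx≢y a′≢x a′≡ (inj₁ refl) e∈ ec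
  ... | inj₂ _ | inj₁ (a′ , a′≢y , a′≡) =
    toward-bound (¬xy ∘ adj-sym T) yq μ μy≢x a′≢y a′≡ (inj₂ refl) e∈ ec
  ... | inj₂ aloneκ | inj₂ aloneμ = pendant-bound xp yq (∈-allEdges⇒≢ e∈K) κ μ aloneκ aloneμ
    (subst (_∈ cycleEdges (K n) T) (sym xy≡) e∈) (subst (λ e → IsTreeCycle T e _) (sym xy≡) ec)
    where xy≡ = orient-≡ (∈-allEdges⇒≢ e∈K) e∈K (inj₁ refl)

-- Trees that are not stars

  -- Two distinct tree-cycles whose cycle intersection numbers exceed 2 (n - 3).
  StrictCycles : Set
  StrictCycles = ∃₂ λ c d → c ≢ d × c ∈ treeCycles (K n) T × d ∈ treeCycles (K n) T ×
    2 * n < 6 + cap c × 2 * n < 6 + cap d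

  -- Let p q r s be consecutive vertices of a path in T and t a further vertex on
  -- the side of r in the cut of qr. Then t r or t s, whichever crosses the cut of
  -- rs, is a cycle-edge that does not cross the cut of qr. It is linked to
  -- ps and to qs through rs, but it is not among the pairs counted across qr.
  strict-bound : ∀ {p q r s t z} → Adj T p q → (qr : Adj T q r) → Adj T r s →
    p ≢ r → q ≢ s → t ≢ r → t ≢ s → (κ : Cut T q r) → side κ t ≡ side κ r → z ≡ p ⊎ z ≡ q →
    orient z s ∈ cycleEdges (K n) T × 2 * n < 6 + cap (cycleOf (orient z s))
  strict-bound {p} {q} {r} {s} {t} {z} pq qr rs p≢r q≢s t≢r t≢s κ t≡r z∈ =
    e∈ , internal-bound κ qr (Adj⇒≢ T pq) κp≡q (Adj⇒≢ T rs ∘ sym) κs≡r e∈ (cycleOf-isTreeCycle e∈)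
      (Crosses-∼ κ (∼-sym (orient-∼ z s)) κz≢s) (h ∷ []) ([] ∷ []) λ { (here refl) → h-extra }
    where
    μ : Cut T r s
    μ = cut T acyclic rs
    κp≡q : side κ p ≡ side κ q
    κp≡q = same-side κ pq λ { (inj₁ refl) → Adj⇒≢ T pq refl ; (inj₂ refl) → p≢r refl }
    κs≡r : side κ s ≡ side κ r
    κs≡r = sym (same-side κ rs λ { (inj₁ refl) → Adj⇒≢ T qr refl ; (inj₂ refl) → q≢s refl })
    μq≡r : side μ q ≡ side μ r
    μq≡r = same-side μ qr λ { (inj₁ refl) → Adj⇒≢ T qr refl ; (inj₂ refl) → q≢s refl }
    μp≡q : side μ p ≡ side μ q
    μp≡q = same-side μ pq λ { (inj₁ refl) → p≢r refl ; (inj₂ refl) → Adj⇒≢ T qr refl }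
    κz≡q : side κ z ≡ side κ q
    κz≡q = [ (λ { refl → κp≡q }) , (λ { refl → refl }) ]′ z∈
    μz≡r : side μ z ≡ side μ r
    μz≡r = [ (λ { refl → trans μp≡q μq≡r }) , (λ { refl → μq≡r }) ]′ z∈
    κz≢s : side κ z ≢ side κ s
    κz≢s eq = separates κ (trans (sym κz≡q) (trans eq κs≡r))
    μz≢s : side μ z ≢ side μ s
    μz≢s eq = separates μ (trans (sym μz≡r) eq)
    e∈ : orient z s ∈ cycleEdges (K n) T
    e∈ = crossing-∈-cycleEdges κ κz≢s
      (λ eq → case (orient-injective eq)) (Adj⇒≢ T qr)
      where
      case : ¬ (z , s) ∼ (q , r)
      case (inj₁ refl) = Adj⇒≢ T rs refl
      case (inj₂ refl) = q≢s refl
    Extra : Fin n → Set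
    Extra u = side μ t ≢ side μ u × side κ t ≡ side κ u
    extra-end : ∃ Extra
    extra-end with side μ t Bool.≟ side μ r
    ... | yes eq = s , (λ eq′ → separates μ (trans (sym eq) eq′)) , trans t≡r (sym κs≡r)
    ... | no ne = r , ne , t≡r
    u = proj₁ extra-end
    h = orient t u
    h-extra : h ∈ cycleEdges (K n) T × Linked (orient z s) h × ¬ Crosses κ h
    h-extra with extra-end
    ... | u , μt≢u , κt≡u =
      crossing-∈-cycleEdges μ μt≢u
        (λ eq → [ t≢r , t≢s ]′ (∼-end (orient-injective eq))) (Adj⇒≢ T rs) ,
      (r , s , rs , μ , Crosses-∼ μ (∼-sym (orient-∼ z s)) μz≢s ,
        Crosses-∼ μ (∼-sym (orient-∼ t u)) μt≢u) ,
      λ cr → Crosses-∼ κ (orient-∼ t u) cr κt≡u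

  strictCycles : ∀ {p q r s t} → Adj T p q → Adj T q r → Adj T r s →
    p ≢ r → q ≢ s → t ≢ r → t ≢ s → (κ : Cut T q r) → side κ t ≡ side κ r → StrictCycles
  strictCycles {p} {q} {r} {s} pq qr rs p≢r q≢s t≢r t≢s κ t≡r
    = cycleOf (orient p s) , cycleOf (orient q s) ,
    (λ eq → differ (orient-injective (cycleOf-injective (proj₁ ps) (proj₁ qs) eq))) ,
    ∈-treeCycles⁺ T (proj₁ ps) (cycleOf-isTreeCycle (proj₁ ps)) ,
    ∈-treeCycles⁺ T (proj₁ qs) (cycleOf-isTreeCycle (proj₁ qs)) ,
    proj₂ ps , proj₂ qs
    where
    ps = strict-bound pq qr rs p≢r q≢s t≢r t≢s κ t≡r (inj₁ refl)
    qs = strict-bound pq qr rs p≢r q≢s t≢r t≢s κ t≡r (inj₂ refl)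
    differ : ¬ (p , s) ∼ (q , s)
    differ (inj₁ refl) = Adj⇒≢ T pq refl
    differ (inj₂ refl) = q≢s refl

  module _ (notStar : ¬ IsStarSpanningTree (K n) T) where

    non-neighbour : ∀ c → ∃ λ v → v ≢ c × ¬ Adj T c v
    non-neighbour c with Fin.any? (λ v → ¬? (v Fin.≟ c) ×-dec ¬? (adj? T c v))
    ... | yes some = some
    ... | no none = contradiction
      (tree , c , λ v v≢c → decidable-stable (adj? T c v) λ ¬cv → none (v , v≢c , ¬cv)) notStar

    -- Without a vertex adjacent to all others, a path with two edges starts at every
    -- vertex.
    two-steps : ∀ u → ∃₂ λ v w → Adj T u v × Adj T v w × u ≢ w
    two-steps u with non-neighbour u
    ... | z , z≢u , ¬uz with loopErase (connected u z)
    ...   | inj₁ u≡z = contradiction (sym u≡z) z≢u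
    ...   | inj₂ ([] , _ , uz ∷ []) = contradiction uz ¬uz
    ...   | inj₂ (v ∷ [] , _ , uv ∷ vz ∷ []) = v , z , uv , vz , z≢u ∘ sym
    ...   | inj₂ (v ∷ w ∷ _ , _ ∷ ((_ ∷ u≢w ∷ _) ∷ _) , uv ∷ vw ∷ _) = v , w , uv , vw , u≢w

    -- Take two steps from u to v to w and two steps from v. If the latter return
    -- through u, extend them backwards by w, and otherwise by u.
    four-path : Fin n → ∃₂ λ p q → ∃₂ λ r s → Adj T p q × Adj T q r × Adj T r s × p ≢ r × q ≢ s
    four-path u with two-steps u
    ... | v , w , uv , vw , u≢w with two-steps v
    ... | x , y , vx , xy , v≢y with x Fin.≟ u
    ...   | yes refl = w , v , u , y , adj-sym T vw , adj-sym T uv , xy , u≢w ∘ sym , v≢y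
    ...   | no x≢u = u , v , x , y , uv , vx , xy , x≢u ∘ sym , v≢y

    -- As n > 4, there is a vertex t off the path. Reversing the path interchanges the
    -- two sides of its middle edge, so t may be assumed to lie on the side of r.
    non-star-strict : 4 < n → StrictCycles
    non-star-strict 4<n with four-path (fromℕ< 4<n)
    ... | p , q , r , s , pq , qr , rs , p≢r , q≢s
      with outside (p ∷ q ∷ r ∷ s ∷ []) 4<n
    ... | t , t∉ = conclude (side κ t Bool.≟ side κ r)
      where
      κ = cut T acyclic qr
      conclude : Dec (side κ t ≡ side κ r) → StrictCycles
      conclude (yes t≡r) = strictCycles pq qr rs p≢r q≢s
        (t∉ ∘ there ∘ there ∘ here) (t∉ ∘ there ∘ there ∘ there ∘ here) κ t≡r
      conclude (no t≢r) = strictCycles (adj-sym T rs) (adj-sym T qr) (adj-sym T pq)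
        (q≢s ∘ sym) (p≢r ∘ sym) (t∉ ∘ there ∘ here) (t∉ ∘ here)
        (flip-cut κ) (two-valued (separates κ) t≢r)

-- The star spanning tree

module StarBounds {n} {T : Graph n} (tree : IsSpanningTree (K n) T)
  {c : Fin n} (hub : ∀ v → v ≢ c → Adj T c v) where

  open SpanningTree tree

  -- Every edge of the star contains the centre c.
  star-adj : ∀ {u v} → Adj T u v → u ≢ c → v ≡ c
  star-adj {u} {v} uv u≢c with v Fin.≟ c
  ... | yes v≡c = v≡c
  ... | no v≢c = contradiction (hub u u≢c)
    (chord∉tree T (v ∷ []) acyclic (λ ())
      (((u≢c ∘ sym) ∷ (v≢c ∘ sym) ∷ []) ∷ (Adj⇒≢ T uv ∷ []) ∷ [] ∷ [])
      (uv ∷ adj-sym T (hub v v≢c) ∷ []))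

  -- A cycle-edge avoids the centre.
  rim : ∀ {a b e} → (a , b) ∼ e → e ∈ cycleEdges (K n) T → a ≢ c × b ≢ c
  rim ab∼e e∈ with ∈-cycleEdges⁻ T e∈
  rim {a} {b} (inj₁ refl) _ | e∈K , ¬ab =
    (λ { refl → ¬ab (hub b (∈-allEdges⇒≢ e∈K ∘ sym)) }) ,
    (λ { refl → ¬ab (adj-sym T (hub a (∈-allEdges⇒≢ e∈K))) })
  rim {a} {b} (inj₂ refl) _ | e∈K , ¬ba =
    (λ { refl → ¬ba (adj-sym T (hub b (∈-allEdges⇒≢ e∈K))) }) ,
    (λ { refl → ¬ba (hub a (∈-allEdges⇒≢ e∈K ∘ sym)) })

  -- The triangle formed by the edge ab and the centre.
  triangle : Edge n → EdgeSet n
  triangle (a , b) = edgeSet (a ∷ b ∷ c ∷ [])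

  -- The part of the cycle inside T starts and ends off the centre, so it alternates
  -- between the centre and other vertices and can pass the centre only once.
  treeCycle⇒triangle : ∀ {e d} → e ∈ cycleEdges (K n) T → IsTreeCycle T e d → d ≡ triangle e
  treeCycle⇒triangle {a , b} e∈ (w , cyc , refl)
    with cycle-through T acyclic (proj₂ (∈-cycleEdges⁻ T e∈)) cyc
  ... | x , y , [] , _ , ne , _ = contradiction refl ne
  ... | x , y , v ∷ vs , xy∼e , _ , uniq , yv ∷ rs , steps↭ with star-adj yv (proj₂ (rim xy∼e e∈))
  treeCycle⇒triangle {a , b} e∈ (w , cyc , refl)
      | x , y , v ∷ [] , xy∼e , _ , uniq , _ , steps↭ | refl =
    edgeSet-cong {w = w} {w′ = a ∷ b ∷ c ∷ []} (λ p∈ → to xy∼e (Perm.∈-resp-↭ steps↭ p∈))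
      (λ p∈ → from xy∼e p∈)
    where
    to : ∀ {p} → (x , y) ∼ (a , b) → p ∈ (x , y) ∷ (y , c) ∷ (c , x) ∷ [] →
      ∃ λ q → q ∈ steps (a ∷ b ∷ c ∷ []) × q ∼ p
    to (inj₁ refl) p∈ = _ , p∈ , inj₁ refl
    to (inj₂ refl) (here refl) = _ , here refl , inj₂ refl
    to (inj₂ refl) (there (here refl)) = _ , there (there (here refl)) , inj₂ refl
    to (inj₂ refl) (there (there (here refl))) = _ , there (here refl) , inj₂ refl
    back : ∀ {p} → (x , y) ∼ (a , b) → p ∈ steps (a ∷ b ∷ c ∷ []) →
      ∃ λ q → q ∈ (x , y) ∷ (y , c) ∷ (c , x) ∷ [] × q ∼ p
    back (inj₁ refl) p∈ = _ , p∈ , inj₁ refl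
    back (inj₂ refl) (here refl) = _ , here refl , inj₂ refl
    back (inj₂ refl) (there (here refl)) = _ , there (there (here refl)) , inj₂ refl
    back (inj₂ refl) (there (there (here refl))) = _ , there (here refl) , inj₂ refl
    from : ∀ {p} → (x , y) ∼ (a , b) → p ∈ steps (a ∷ b ∷ c ∷ []) → ∃ λ q → q ∈ steps w × q ∼ p
    from xy∼e p∈ with back xy∼e p∈
    ... | q , q∈ , q∼p = q , Perm.∈-resp-↭ (↭-sym steps↭) q∈ , q∼p
  treeCycle⇒triangle e∈ _
      | x , y , v ∷ u ∷ [] , xy∼e , _ , _ ∷ (_ ∷ ((v≢u ∷ _) ∷ _)) , _ ∷ _ ∷ ux ∷ [] , _ | refl =
    contradiction (star-adj ux (v≢u ∘ sym)) (proj₁ (rim xy∼e e∈))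
  treeCycle⇒triangle e∈ _
      | x , y , v ∷ u ∷ t ∷ _ , xy∼e , _ , _ ∷ (_ ∷ ((v≢u ∷ v≢t ∷ _) ∷ _)) ,
        _ ∷ _ ∷ ut ∷ _ , _ | refl =
    contradiction (sym (star-adj ut (v≢u ∘ sym))) v≢t

  -- A tree edge in the triangle of xy joins x or y to the centre.
  spoke : ∀ {x y g} → (x , y) ∈ cycleEdges (K n) T → g ∈ triangle (x , y) → g ∈ edges T →
    ∃₂ λ p q → (p , q) ∼ (x , y) × (p , c) ∼ g
  spoke {x} {y} e∈ g∈ g∈T with edgeSet-∈⁻ {w = x ∷ y ∷ c ∷ []} g∈
  ... | _ , _ , here refl , xy∼g =
    contradiction (Adj-∼ T (∼-sym xy∼g) (proj₂ (∈-edges⁻ T g∈T))) (proj₂ (∈-cycleEdges⁻ T e∈))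
  ... | _ , _ , there (here refl) , yc∼g = y , x , inj₂ refl , yc∼g
  ... | _ , _ , there (there (here refl)) , cx∼g = x , y , inj₁ refl , ∼-trans (inj₂ refl) cx∼g

  -- Another triangle meeting that of xy shares a spoke with it. Its cycle-edge thus
  -- joins x or y to one of the n - 3 vertices other than x, y and c.
  star-cycle-bound : ∀ {d} → d ∈ treeCycles (K n) T →
    6 + cycleIntersectionNumber (K n) T d ≤ 2 * n
  star-cycle-bound {d} d∈ with ∈-treeCycles⁻ T d∈
  ... | (x , y) , e∈ , ed with ∈-cycleEdges⁻ T e∈
  ... | e∈K , _ = begin
    6 + cycleIntersectionNumber (K n) T d
      ≤⟨ ℕ.+-monoʳ-≤ 6 (unique-⊆⇒length≤ (Unique.filter⁺ _ (treeCycles-unique T)) into) ⟩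
    6 + length (map triangle neighbours)
      ≡⟨ cong (6 +_) (trans (List.length-map triangle neighbours)
           (trans (List.length-++ (map (orient x) O))
             (cong₂ _+_ (List.length-map (orient x) O) (List.length-map (orient y) O)))) ⟩
    6 + (length O + length O) ≡⟨ rearrange (length O) ⟩
    2 * (3 + length O) ≤⟨ ℕ.*-monoʳ-≤ 2 (length-others≤ xyc-unique) ⟩
    2 * n ∎
    where
    open ℕ.≤-Reasoning
    rearrange : ∀ l → 6 + (l + l) ≡ 2 * (3 + l)
    rearrange = solve-∀
    xyc O : List (Fin n)
    xyc = x ∷ y ∷ c ∷ []
    O = others xyc
    neighbours : List (Edge n)
    neighbours = map (orient x) O ++ map (orient y) O
    x≢y : x ≢ y
    x≢y = ∈-allEdges⇒≢ e∈K
    xyc-unique : Unique xyc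
    xyc-unique with rim (inj₁ refl) e∈
    ... | x≢c , y≢c = (x≢y ∷ x≢c ∷ []) ∷ (y≢c ∷ []) ∷ [] ∷ []
    -- Here p is the common end of f and xy, and z is the other end of f.
    neighbour : ∀ {f p q z} → f ∈ cycleEdges (K n) T → f ≢ (x , y) →
      (p , q) ∼ (x , y) → (p , z) ∼ f → f ∈ neighbours
    neighbour {f} {p} {q} {z} f∈ f≢e pq∼e pz∼f = place (∼-end pq∼e)
      where
      f∈K = proj₁ (∈-cycleEdges⁻ T f∈)
      p≢z : p ≢ z
      p≢z = ends-≢ f∈K pz∼f
      z≢q : z ≢ q
      z≢q refl = f≢e (∼⇒≡ f∈K e∈K (∼-trans (∼-sym pz∼f) pq∼e))
      z∉ : z ∉ xyc
      z∉ (here refl) = [ p≢z ∘ sym , z≢q ]′ (∼-end (∼-sym pq∼e))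
      z∉ (there (here refl)) = [ p≢z ∘ sym , z≢q ]′ (∼-end (∼-trans (inj₂ refl) (∼-sym pq∼e)))
      z∉ (there (there (here refl))) = proj₂ (rim pz∼f f∈) refl
      f≡ : orient p z ≡ f
      f≡ = orient-≡ p≢z f∈K pz∼f
      place : p ≡ x ⊎ p ≡ y → f ∈ neighbours
      place (inj₁ refl) = ∈-++⁺ˡ
        (subst (_∈ map (orient x) O) f≡ (∈-map⁺ (orient x) (∈-others⁺ z∉)))
      place (inj₂ refl) = ∈-++⁺ʳ (map (orient x) O)
        (subst (_∈ map (orient y) O) f≡ (∈-map⁺ (orient y) (∈-others⁺ z∉)))
    into : filter (λ c′ → ¬? (c′ ≟ˢ d) ×-dec intersect? T d c′) (treeCycles (K n) T) ⊆
      map triangle neighbours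
    into {d′} d′∈ with ∈-filter⁻ (λ c′ → ¬? (c′ ≟ˢ d) ×-dec intersect? T d c′)
      {xs = treeCycles (K n) T} d′∈
    ... | d′∈L , d′≢d , meet with ∈-treeCycles⁻ T d′∈L | find meet
    ... | f , f∈ , fd′ | g , g∈d , g∈d′ , g∈T =
      subst (_∈ map triangle neighbours) (sym d′≡)
        (∈-map⁺ triangle (meeting (spoke e∈ (subst (g ∈_) d≡ g∈d) g∈T)
          (spoke f∈ (subst (g ∈_) d′≡ g∈d′) g∈T)))
      where
      d≡ = treeCycle⇒triangle e∈ ed
      d′≡ = treeCycle⇒triangle f∈ fd′
      meeting : (∃₂ λ p q → (p , q) ∼ (x , y) × (p , c) ∼ g) →
        (∃₂ λ p q → (p , q) ∼ f × (p , c) ∼ g) →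
        f ∈ neighbours
      meeting (p , q , pq∼e , pc∼g) (p′ , z , p′z∼f , p′c∼g) with ∼-trans pc∼g (∼-sym p′c∼g)
      ... | inj₁ refl = neighbour f∈ (λ { refl → d′≢d (trans d′≡ (sym d≡)) }) pq∼e p′z∼f
      ... | inj₂ refl = contradiction refl (proj₁ (rim pq∼e e∈))

  treeCycles≤cycleEdges : length (treeCycles (K n) T) ≤ length (cycleEdges (K n) T)
  treeCycles≤cycleEdges = ℕ.≤-trans (unique-⊆⇒length≤ (treeCycles-unique T) into)
    (ℕ.≤-reflexive (List.length-map triangle (cycleEdges (K n) T)))
    where
    into : treeCycles (K n) T ⊆ map triangle (cycleEdges (K n) T)
    into d∈ with ∈-treeCycles⁻ T d∈
    ... | e , e∈ , ed =
      subst (_∈ map triangle (cycleEdges (K n) T)) (sym (treeCycle⇒triangle e∈ ed))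
        (∈-map⁺ triangle e∈)

-- The k edges at the centre are not cycle-edges.
star-cycleEdges≤ : ∀ {k} (T : Graph (suc k)) {c} → (∀ v → v ≢ c → Adj T c v) →
  length (cycleEdges (K (suc k)) T) + k ≤ length (allEdges (suc k))
star-cycleEdges≤ {k} T {c} hub = subst (_≤ length (allEdges (suc k)))
  (trans (List.length-++ C) (cong (length C +_)
    (trans (List.length-map spokeTo (allFin k)) (length-allFin k))))
  (unique-⊆⇒length≤ (Unique.++⁺ (cycleEdges-unique T)
      (Unique.map⁺ (λ {i} {j} eq → injective i j (orient-injective eq))
        (Unique.allFin⁺ k)) disjoint) into)
  where
  C = cycleEdges (K (suc k)) T
  spokeTo : Fin k → Edge (suc k)
  spokeTo i = orient c (punchIn c i)
  injective : ∀ i j → (c , punchIn c i) ∼ (c , punchIn c j) → i ≡ j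
  injective i j (inj₁ eq) = Fin.punchIn-injective c i j (cong proj₂ eq)
  injective i j (inj₂ eq) = contradiction (cong proj₁ eq) (Fin.punchInᵢ≢i c i)
  disjoint : ∀ {e} → ¬ (e ∈ C × e ∈ map spokeTo (allFin k))
  disjoint (e∈C , e∈S) with ∈-map⁻ spokeTo e∈S
  ... | i , _ , refl = proj₂ (∈-cycleEdges⁻ T e∈C)
    (Adj-∼ T (∼-sym (orient-∼ c (punchIn c i))) (hub _ (Fin.punchInᵢ≢i c i)))
  into : C ++ map spokeTo (allFin k) ⊆ allEdges (suc k)
  into e∈ with ∈-++⁻ C e∈
  ... | inj₁ e∈C = proj₁ (∈-cycleEdges⁻ T e∈C)
  ... | inj₂ e∈S with ∈-map⁻ spokeTo e∈S
  ...   | i , _ , refl = orient-∈ (Fin.punchInᵢ≢i c i ∘ sym)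

halve-< : ∀ {s t} → 2 + s ≤ t → s / 2 < t / 2
halve-< {s} 2+s≤t = ℕ.≤-trans
  (ℕ.≤-reflexive (sym (m/n≡1+[m∸n]/n {2 + s} {2} (s≤s (s≤s z≤n)))))
  (/-monoˡ-≤ 2 2+s≤t)

corollary8 : (n : ℕ) → 4 < n →
    (Tₛ : Graph n) → IsStarSpanningTree (K n) Tₛ →
    (T : Graph n) → IsSpanningTree (K n) T → ¬ IsStarSpanningTree (K n) T →
    treeIntersectionNumber (K n) Tₛ < treeIntersectionNumber (K n) T
corollary8 n@(suc k) 4<n Tₛ (treeₛ , c , hub) T tree notStar =
  halve-< (compare (TreeBounds.non-star-strict tree notStar 4<n))
  where
  L Lₛ : List (EdgeSet n)
  L  = treeCycles (K n) T
  Lₛ = treeCycles (K n) Tₛ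
  capₛ cap : EdgeSet n → ℕ
  cap  = cycleIntersectionNumber (K n) T
  capₛ = cycleIntersectionNumber (K n) Tₛ
  -- This is 2 (n - 3), since n > 4 makes the truncated subtraction exact.
  b : ℕ
  b = 2 * n ∸ 6
  2n≡6+b : 2 * n ≡ 6 + b
  2n≡6+b = sym (ℕ.m+[n∸m]≡n (ℕ.≤-trans (ℕ.m≤m+n 6 4) (ℕ.*-monoʳ-≤ 2 4<n)))
  -- In fact both trees have as many tree-cycles as cycle-edges, and equally many;
  -- only this inequality is needed.
  fewer : length Lₛ ≤ length L
  fewer = begin
    length Lₛ ≤⟨ StarBounds.treeCycles≤cycleEdges treeₛ hub ⟩
    length (cycleEdges (K n) Tₛ)
      ≤⟨ ℕ.+-cancelʳ-≤ k _ _ (ℕ.≤-trans (star-cycleEdges≤ Tₛ hub) (allEdges≤ tree)) ⟩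
    length (cycleEdges (K n) T) ≤⟨ SpanningTree.cycleEdges≤treeCycles tree ⟩
    length L ∎
    where open ℕ.≤-Reasoning
  compare : TreeBounds.StrictCycles tree → 2 + sum (map capₛ Lₛ) ≤ sum (map cap L)
  compare (x , y , x≢y , x∈ , y∈ , x< , y<) = begin
    2 + sum (map capₛ Lₛ) ≤⟨ ℕ.+-monoʳ-≤ 2 (sum-map-≤ capₛ b Lₛ λ d∈ →
      ℕ.+-cancelˡ-≤ 6 _ _
        (ℕ.≤-trans (StarBounds.star-cycle-bound treeₛ hub d∈) (ℕ.≤-reflexive 2n≡6+b))) ⟩
    2 + length Lₛ * b ≤⟨ ℕ.+-monoʳ-≤ 2 (ℕ.*-monoˡ-≤ b fewer) ⟩
    2 + length L * b ≤⟨ sum-map-≥₂ cap b L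
      (λ d∈ → ℕ.+-cancelˡ-≤ 6 _ _
        (ℕ.≤-trans (ℕ.≤-reflexive (sym 2n≡6+b)) (TreeBounds.cycle-bound tree d∈)))
      x∈ y∈ x≢y (exceeds x<) (exceeds y<) ⟩
    sum (map cap L) ∎
    where
    open ℕ.≤-Reasoning
    exceeds : ∀ {m} → 2 * n < 6 + m → b < m
    exceeds lt = ℕ.+-cancelˡ-< 6 _ _ (ℕ.≤-<-trans (ℕ.≤-reflexive (sym 2n≡6+b)) lt)
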